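{- For every integer $k \ge 2$ there exists a constant $c_k > 0$ such that for every positive integer $m$ there is a $k$-uniform hypergraph $H$ with $m$ edges and no isolated vertices whose $4$-color Ramsey number satisfies \[ r_k(H;4) \ge \mathrm{tw}_k\left(c_k\sqrt{m}\right). \]
   Context: For a $k$-uniform hypergraph $H$ and a positive integer $q$, the $q$-color Ramsey number $r_k(H;q)$ is the minimum integer $N$ such that every coloring of the edges of the complete $k$-uniform hypergraph $K_N^{(k)}$ on $N$ vertices with $q$ colors contains a monochromatic copy of $H$ (as a not necessarily induced subhypergraph). The tower function is defined by $\mathrm{tw}_1(x)=x$ and $\mathrm{tw}_k(x)=2^{\mathrm{tw}_{k-1}(x)}$ for $k\ge 2$. A vertex is isolated if it lies in no edge.
   Formalization: Proved for all m sufficiently large in terms of k instead of every positive integer m: for k ≥ 4 and m = 1 the only H is a single edge with Ramsey number k, which is less than tw_k(c) for every c > 0. -}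

module Defs where

open import Algebra.Definitions.RawSemiring using (_^_)
open import Data.Fin using (Fin)
open import Data.Fin.Subset using (Subset; ∣_∣; _∈_)
open import Data.Integer using (+_)
open import Data.List using (List; length)
import Data.List.Membership.Propositional as List
open import Data.List.Relation.Unary.Unique.Propositional using (Unique)
open import Data.Nat as ℕ using (ℕ; zero; suc)
open import Data.Product using (∃; ∃-syntax; _×_; proj₁)
open import Data.Rational as ℚ using (ℚ; 0ℚ; _/_; +-*-rawSemiring)
open import Function.Bundles using (_⇔_)
open import Function.Definitions using (Injective)
open import Relation.Binary.PropositionalEquality using (_≡_)

------------------------------------------------------------------------
-- Hypergraphs and Ramsey numbers

-- The edges of the complete k-uniform hypergraph on Fin n.
Edge : ℕ → ℕ → Set
Edge k n = ∃ λ (e : Subset n) → ∣ e ∣ ≡ k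

record Hypergraph (k : ℕ) : Set where
  field
    order    : ℕ
    edges    : List (Edge k order)
    distinct : Unique edges

  size : ℕ
  size = length edges

  NoIsolatedVertices : Set
  NoIsolatedVertices =
    ∀ (x : Fin order) → ∃[ e ] (e List.∈ edges × x ∈ proj₁ e)

open Hypergraph public using (size; NoIsolatedVertices)

IsImage : ∀ {k v n} → (Fin v → Fin n) → Edge k v → Edge k n → Set
IsImage f e e′ = ∀ y → y ∈ proj₁ e′ ⇔ (∃[ x ] (x ∈ proj₁ e × f x ≡ y))

Coloring : ℕ → ℕ → ℕ → Set
Coloring k n q = Edge k n → Fin q

-- Non-edges of H are unconstrained: copies need not be induced.
MonochromaticCopy : ∀ {k n q} → Hypergraph k → Coloring k n q → Fin q → Set
MonochromaticCopy {n = n} H χ i =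
  ∃ λ (f : Fin order → Fin n) →
    Injective _≡_ _≡_ f ×
    (∀ e → e List.∈ edges → ∃[ e′ ] (IsImage f e e′ × χ e′ ≡ i))
  where open Hypergraph H

IsRamsey : ∀ {k} → Hypergraph k → ℕ → ℕ → Set
IsRamsey {k} H q n = ∀ (χ : Coloring k n q) → ∃[ i ] MonochromaticCopy H χ i

-- r = r_k(H; q).  At most one r satisfies this, and one does by Ramsey's
-- theorem.
IsRamseyNumber : ∀ {k} → Hypergraph k → ℕ → ℕ → Set
IsRamseyNumber H q r = IsRamsey H q r × (∀ n → IsRamsey H q n → r ℕ.≤ n)

------------------------------------------------------------------------
-- The tower function at real arguments

-- A nonnegative real is represented by an inhabited, bounded set of
-- nonnegative rationals of which it is the supremum.  The set need not be
-- downward closed, and may or may not contain its supremum.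
ℝ₊ : Set₁
ℝ₊ = ℚ → Set

√_ : ℕ → ℝ₊
(√ m) p = 0ℚ ℚ.≤ p × p ℚ.* p ℚ.≤ + m / 1

-- For c ≥ 0.
_·_ : ℚ → ℝ₊ → ℝ₊
(c · x) p = ∃[ s ] (x s × p ≡ c ℚ.* s)

-- 2^x is the supremum of 2^(a/b) over the a/b in x, and for p ≥ 0 and b ≥ 1
-- we have p ≤ 2^(a/b) iff p^b ≤ 2^a.
2^_ : ℝ₊ → ℝ₊
(2^ x) p = 0ℚ ℚ.≤ p ×
  ∃[ a ] ∃[ b ] (x (+ a / suc b) × p ^ℚ suc b ℚ.≤ + (2 ℕ.^ a) / 1)
  where
  _^ℚ_ = _^_ +-*-rawSemiring

-- x ≤ n, as an upper-bound condition on the set representing x.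
_≤ᴿ_ : ℝ₊ → ℕ → Set
x ≤ᴿ n = ∀ p → x p → p ℚ.≤ + n / 1

-- tw k is tw_k for k ≥ 1; the value at k = 0 is junk.
--
-- Even at argument 0 the tower grows with k (0, 1, 2, 4, 16, …), whereas a
-- single k-edge has Ramsey number k.  So for k ≥ 4 and c > 0 the bound
-- tw_k(c√m) ≤ r_k(H; q) fails at m = 1 for the only possible H, and it can
-- only be claimed for m large in terms of k.
tw : ℕ → ℝ₊ → ℝ₊
tw zero          x = x
tw (suc zero)    x = x
tw (suc (suc k)) x = 2^ (tw (suc k) x)

infix  9 √_
infixr 8 2^_
infixr 7 _·_
infix  4 _≤ᴿ_

{-# OPTIONS --safe #-}

-- The hypergraph has about √m blocks of constant size, and its edges are all k-sets inside the union
-- of two blocks.  Erdős and Hajnal's stepping-up, which colours an edge x₁ < … < xₖ₊₁ by means of the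
-- highest bits δᵢ in which consecutive vertices differ, turns a colouring of [N] into one of [2 ^ N].
-- A monochromatic copy of the hypergraph is sent back to a monochromatic copy of the one with k
-- lowered by one: two blocks at a time lie in a complete hypergraph of constant size, where one
-- finds parts of the blocks on whose union all the sequences δ are monotone, and then the levels at
-- which the vertices of a block branch off from its first vertex are the new block.  Two colours
-- suffice for pairs, the sign of δ₁ - δ₂ doubles them for triples, and from there on four colours are
-- enough because the colours of local maxima and local minima of δ can be reused.

module Submission where

open import Defs
open import Algebra.Definitions.RawSemiring using () renaming (_^_ to rawPower)
open import Data.Bool using (Bool; true; false; if_then_else_; T)
import Data.Bool.Properties as Boolₚ
open import Data.Empty as Empty using (⊥-elim)
open import Data.Fin as Fin using (Fin; zero; suc; toℕ; fromℕ<; combine)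
open import Data.Fin.Patterns using (0F; 1F; 2F; 3F)
import Data.Fin.Properties as Finₚ
open import Data.Fin.Subset using (Subset; inside; outside; ∣_∣; _∈_; _∉_; _⊆_; _∪_; _-_; ⁅_⁆; ⊥; ⊤)
import Data.Fin.Subset.Properties as Subsetₚ
open import Data.Integer as ℤ using ()
import Data.Integer.Properties as ℤₚ
open import Data.List
  using (List; []; _∷_; _++_; _∷ʳ_; length; map; filter; reverse; applyUpTo; allFin;
         cartesianProduct; cartesianProductWith; concatMap; deduplicate)
import Data.List.Membership.Propositional as List
open import Data.List.Membership.Propositional.Properties
  using (∈-map⁺; ∈-map⁻; ∈-++⁺ˡ; ∈-++⁺ʳ; ∈-++⁻; ∈-allFin; ∈-cartesianProductWith⁺;
         ∈-cartesianProduct⁺; ∈-concatMap⁺; ∈-deduplicate⁺; ∈-filter⁺)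
open import Data.List.Properties
  using (length-map; length-++; length-reverse; length-applyUpTo; length-filter; length-tabulate;
         length-deduplicate; unfold-reverse; reverse-involutive)
open import Data.List.Relation.Binary.Permutation.Propositional using (_↭_; ↭-sym; ↭⇒↭ₛ)
open import Data.List.Relation.Binary.Permutation.Propositional.Properties
  using (↭-reverse; All-resp-↭; ∈-resp-↭; ↭-length)
import Data.List.Relation.Binary.Permutation.Setoid.Properties as Permutationₚ
open import Data.List.Relation.Unary.All as All using (All; []; _∷_)
import Data.List.Relation.Unary.All.Properties as Allₚ
open import Data.List.Relation.Unary.AllPairs as AllPairs using (AllPairs; []; _∷_)
import Data.List.Relation.Unary.AllPairs.Properties as AllPairsₚ
open import Data.List.Relation.Unary.Any using (here; there)
open import Data.List.Relation.Unary.Sorted.TotalOrder.Properties using (Sorted⇒AllPairs)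
open import Data.List.Relation.Unary.Unique.Propositional using (Unique)
import Data.List.Relation.Unary.Unique.DecPropositional.Properties as DecUniqueₚ
import Data.List.Relation.Unary.Unique.Propositional.Properties as Uniqueₚ
open import Data.Nat
  using (ℕ; zero; suc; _+_; _*_; _∸_; _^_; _≤_; _<_; _>_; z≤n; s≤s; ⌊_/2⌋; ⌈_/2⌉; _≟_; _<?_;
         _≤?_; _<ᵇ_)
open import Data.Nat.ListAction using (sum)
open import Data.Nat.Properties
open import Data.List.Sort ≤-decTotalOrder using (sort; sort-↭; sort-↗)
open import Data.Nat.Tactic.RingSolver using (solve-∀)
open import Data.Product using (∃; _×_; _,_; proj₁; proj₂)
open import Data.Rational as ℚ using (ℚ; 0ℚ; _/_; toℚᵘ; +-*-rawSemiring)
import Data.Rational.Properties as ℚₚ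
open import Data.Rational.Unnormalised as ℚᵘ using (mkℚᵘ)
import Data.Rational.Unnormalised.Properties as ℚᵘₚ
open import Data.Sum as Sum using (_⊎_; inj₁; inj₂; [_,_])
open import Data.Unit using (tt)
open import Data.Vec as Vec using (Vec; []; _∷_; lookup; here; there)
import Data.Vec.Properties as Vecₚ
open import Function using (_∘_; case_of_; flip)
open import Function.Bundles using (mk⇔; Equivalence)
open import Relation.Binary using (tri<; tri≈; tri>)
open import Relation.Binary.Definitions using (DecidableEquality)
open import Relation.Binary.PropositionalEquality hiding ([_])
open import Relation.Nullary using (¬_; Dec; yes; no; contradiction)

-- Stepping up along the highest differing bit

-- No edge meets three blocks, so every argument sees two blocks at a time. Yet what is kept of a
-- block has to be the same for all its partners, and the direction in which δ is monotone the same
-- for all pairs. The device from uniformity three upwards is a sign read off three vertices in the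
-- middle of each block. Once local minima of δ, or local maxima, are excluded, this sign spreads to
-- every triple in the kept parts that has the middle of one of its blocks entirely after it or
-- entirely before it. Keeping the blocks with the commoner sign, and of each block either the part
-- before its middle or the part after it, settles all pairs simultaneously. Each such step costs
-- half of the blocks and a number of vertices per block that depends on the uniformity only, and it
-- removes one exponential from the number of vertices. At the bottom a colouring of the pairs of
-- `2 ^ n` vertices without monochromatic cliques on `4 * n` vertices remains. So the number of
-- blocks is linear in `n`, the number of edges is quadratic in `n`, and this is the origin of √m.

-- For distinct x, y < 2 ^ K, the highest bit in which x and y differ; junk for other arguments.
δ : ℕ → ℕ → ℕ → ℕ
δ zero    x y = 0
δ (suc K) x y with ⌊ x /2⌋ ≟ ⌊ y /2⌋
... | yes _ = 0
... | no  _ = suc (δ K ⌊ x /2⌋ ⌊ y /2⌋)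

δ-sym : ∀ K x y → δ K x y ≡ δ K y x
δ-sym zero    x y = refl
δ-sym (suc K) x y with ⌊ x /2⌋ ≟ ⌊ y /2⌋ | ⌊ y /2⌋ ≟ ⌊ x /2⌋
... | yes _ | yes _ = refl
... | yes p | no  q = contradiction (sym p) q
... | no  p | yes q = contradiction (sym q) p
... | no  _ | no  _ = cong suc (δ-sym K _ _)

⌊n/2⌋<2^ : ∀ K {x} → x < 2 ^ suc K → ⌊ x /2⌋ < 2 ^ K
⌊n/2⌋<2^ K {x} x< = ≰⇒> λ 2^K≤ → <⇒≱ x< (begin
  2 ^ suc K               ≡⟨ cong (2 ^ K +_) (+-identityʳ (2 ^ K)) ⟩
  2 ^ K + 2 ^ K           ≤⟨ +-mono-≤ 2^K≤ (≤-trans 2^K≤ (⌊n/2⌋≤⌈n/2⌉ x)) ⟩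
  ⌊ x /2⌋ + ⌈ x /2⌉       ≡⟨ ⌊n/2⌋+⌈n/2⌉≡n x ⟩
  x                       ∎)
  where open ≤-Reasoning

⌊n/2⌋-<-or-≡ : ∀ {x y} → x < y → ⌊ x /2⌋ < ⌊ y /2⌋ ⊎ ⌊ x /2⌋ ≡ ⌊ y /2⌋
⌊n/2⌋-<-or-≡ x<y = m≤n⇒m<n∨m≡n (⌊n/2⌋-mono (<⇒≤ x<y))

δ-< : ∀ K {x y} → x < y → y < 2 ^ K → δ K x y < K
δ-< zero    {x} x<y y< = contradiction (<-≤-trans x<y (≤-pred y<)) λ ()
δ-< (suc K) {x} {y} x<y y< with ⌊ x /2⌋ ≟ ⌊ y /2⌋
... | yes _ = s≤s z≤n
... | no  p with ⌊n/2⌋-<-or-≡ x<y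
...   | inj₁ l = s≤s (δ-< K l (⌊n/2⌋<2^ K y<))
...   | inj₂ e = contradiction e p

-- Halving drops the lowest bit. The halves of `x` and `z` differ because `z` is at least `x + 2`,
-- so at most one of the two consecutive pairs collapses; a collapsed pair has level 0, below the
-- level of the other. If none collapses, the induction hypothesis applies to the halves.
δ-ultra : ∀ K {x y z} → x < y → y < z → z < 2 ^ K →
          (δ K x y < δ K y z × δ K x z ≡ δ K y z) ⊎ (δ K y z < δ K x y × δ K x z ≡ δ K x y)
δ-ultra zero    x<y y<z z< = contradiction (<-≤-trans y<z (≤-pred z<)) λ ()
δ-ultra (suc K) {x} {y} {z} x<y y<z z<
  with ⌊n/2⌋-<-or-≡ x<y | ⌊n/2⌋-<-or-≡ y<z | ⌊n/2⌋-mono (≤-trans (s≤s x<y) y<z)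
... | inj₂ p | inj₂ q | l = contradiction (trans p q) (<⇒≢ l)
... | a | b | l with ⌊ x /2⌋ ≟ ⌊ y /2⌋ | ⌊ y /2⌋ ≟ ⌊ z /2⌋ | ⌊ x /2⌋ ≟ ⌊ z /2⌋
... | _     | yes q | yes r = contradiction r (<⇒≢ l)
... | yes p | _     | yes r = contradiction r (<⇒≢ l)
... | no  _ | no _  | yes r = contradiction r (<⇒≢ l)
... | yes p | yes q | no  _ = contradiction (trans p q) (<⇒≢ l)
... | yes p | no  _ | no  _ = inj₁ (s≤s z≤n , cong (λ h → suc (δ K h _)) p)
... | no  _ | yes q | no  _ = inj₂ (s≤s z≤n , cong (λ h → suc (δ K _ h)) (sym q))
... | no ¬p | no ¬q | no  _ with a | b
...   | inj₂ p | _ = contradiction p ¬p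
...   | inj₁ _ | inj₂ q = contradiction q ¬q
...   | inj₁ p | inj₁ q = Sum.map (λ (h , e) → s≤s h , cong suc e) (λ (h , e) → s≤s h , cong suc e)
                            (δ-ultra K p q (⌊n/2⌋<2^ K z<))

deltas : (ℕ → ℕ → ℕ) → List ℕ → List ℕ
deltas d []           = []
deltas d (x ∷ [])     = []
deltas d (x ∷ y ∷ xs) = d x y ∷ deltas d (y ∷ xs)

deltas-∷ʳ : ∀ d xs x y → deltas d (xs ∷ʳ x ∷ʳ y) ≡ deltas d (xs ∷ʳ x) ∷ʳ d x y
deltas-∷ʳ d []           x y = refl
deltas-∷ʳ d (_ ∷ [])     x y = refl
deltas-∷ʳ d (_ ∷ _ ∷ xs) x y = cong (_ ∷_) (deltas-∷ʳ d (_ ∷ xs) x y)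

deltas-reverse : ∀ d → (∀ x y → d x y ≡ d y x) → ∀ xs → deltas d (reverse xs) ≡ reverse (deltas d xs)
deltas-reverse d d-sym []           = refl
deltas-reverse d d-sym (x ∷ [])     = refl
deltas-reverse d d-sym (x ∷ y ∷ xs) = begin
  deltas d (reverse (x ∷ y ∷ xs))             ≡⟨ cong (deltas d) (unfold-reverse x (y ∷ xs)) ⟩
  deltas d (reverse (y ∷ xs) ∷ʳ x)            ≡⟨ cong (λ l → deltas d (l ∷ʳ x)) (unfold-reverse y xs) ⟩
  deltas d (reverse xs ∷ʳ y ∷ʳ x)             ≡⟨ deltas-∷ʳ d (reverse xs) y x ⟩
  deltas d (reverse xs ∷ʳ y) ∷ʳ d y x         ≡⟨ cong₂ _∷ʳ_ (cong (deltas d) (sym (unfold-reverse y xs))) (d-sym y x) ⟩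
  deltas d (reverse (y ∷ xs)) ∷ʳ d x y        ≡⟨ cong (_∷ʳ _) (deltas-reverse d d-sym (y ∷ xs)) ⟩
  reverse (deltas d (y ∷ xs)) ∷ʳ d x y        ≡⟨ unfold-reverse _ (deltas d (y ∷ xs)) ⟨
  reverse (deltas d (x ∷ y ∷ xs))             ∎
  where open ≡-Reasoning

AllPairs-reverse : ∀ {R : ℕ → ℕ → Set} {xs} → AllPairs R xs → AllPairs (flip R) (reverse xs)
AllPairs-reverse []                     = []
AllPairs-reverse {R} {x ∷ xs} (px ∷ ps) = subst (AllPairs (flip R)) (sym (unfold-reverse x xs))
  (AllPairsₚ.++⁺ (AllPairs-reverse ps) ([] ∷ []) (All.map (_∷ []) (All-resp-↭ (↭-sym (↭-reverse xs)) px)))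

-- Block systems and their descent along monotone δ

Block : ∀ {n} → ℕ → (Fin n → ℕ → ℕ) → Fin n → ℕ → Set
Block S b i x = ∃ λ p → p < S × b i p ≡ x

InPair : ∀ {n} → ℕ → (Fin n → ℕ → ℕ) → Fin n → Fin n → ℕ → Set
InPair S b i j x = Block S b i x ⊎ Block S b j x

-- Colourings are functions of the ascending list of the vertices of an edge.  Only the values b i p
-- with p < S matter.
record BlockSystem {C : Set} (k S : ℕ) (χ : List ℕ → C) (c : C) (N : ℕ) {n : ℕ} (b : Fin n → ℕ → ℕ) : Set where
  field
    ascending : ∀ i {p q} → p < q → q < S → b i p < b i q
    bounded   : ∀ i {p} → p < S → b i p < N
    disjoint  : ∀ {i j p q} → i ≢ j → p < S → q < S → b i p ≢ b j q
    mono      : ∀ i j xs → length xs ≡ k → AllPairs _<_ xs → All (InPair S b i j) xs → χ xs ≡ c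

-- The order `_◁_` is a parameter so that decreasing δ can be treated as increasing along `_>_`,
-- with the blocks read backwards.
module Descent
  {C : Set} {k S N n : ℕ} (χ : List ℕ → C) (c : C)
  (_◁_ : ℕ → ℕ → Set)
  (◁-trans : ∀ {x y z} → x ◁ y → y ◁ z → x ◁ z)
  (◁-total : ∀ {x y} → x ≢ y → x ◁ y ⊎ y ◁ x)
  (d : ℕ → ℕ → ℕ)
  (u : Fin n → ℕ → ℕ)
  (u-ascending : ∀ i {p q} → p < q → q < suc S → u i p ◁ u i q)
  (u-disjoint : ∀ {i j p q} → i ≢ j → p < suc S → q < suc S → u i p ≢ u j q)
  (up : ∀ i j {x y z} → InPair (suc S) u i j x → InPair (suc S) u i j y → InPair (suc S) u i j z →
        x ◁ y → y ◁ z → d x y < d y z × d x z ≡ d y z)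
  (d-bounded : ∀ i {x y} → Block (suc S) u i x → Block (suc S) u i y → x ◁ y → d x y < N)
  (u-mono : ∀ i j xs → length xs ≡ suc k → AllPairs _◁_ xs → All (InPair (suc S) u i j) xs →
            χ (deltas d xs) ≡ c)
  where

  -- Levels are measured from the block's own first vertex, since the new block must not depend on
  -- its partner. The earlier of the two first vertices of a pair measures the same levels for both
  -- blocks, by the equation in `up`.
  v : Fin n → ℕ → ℕ
  v i p = d (u i 0) (u i (suc p))

  private
    In : Fin n → Fin n → ℕ → Set
    In = InPair (suc S) u

    in₁ : ∀ {i j p} → p < suc S → In i j (u i p)
    in₁ p< = inj₁ (_ , p< , refl)

    in₂ : ∀ {i j p} → p < suc S → In i j (u j p)
    in₂ p< = inj₂ (_ , p< , refl)

    -- A common root: every difference level of the two blocks is the level at which some vertex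
    -- branches off from m.
    Root : Fin n → Fin n → ℕ → Set
    Root i j m = In i j m × (∀ l → l ≡ i ⊎ l ≡ j → ∀ {p} → p < S →
                  m ◁ u l (suc p) × d m (u l (suc p)) ≡ v l p)

    root : ∀ i j → ∃ (Root i j)
    root i j with i Finₚ.≟ j
    ... | yes refl = u i 0 , in₁ (s≤s z≤n) , λ where
          l (inj₁ refl) p< → u-ascending i (s≤s z≤n) (s≤s p<) , refl
          l (inj₂ refl) p< → u-ascending i (s≤s z≤n) (s≤s p<) , refl
    ... | no i≢j with ◁-total (u-disjoint i≢j (s≤s z≤n) (s≤s z≤n))
    ...   | inj₁ i◁j = u i 0 , in₁ (s≤s z≤n) , λ where
          l (inj₁ refl) p< → u-ascending i (s≤s z≤n) (s≤s p<) , refl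
          l (inj₂ refl) p< → let j◁ = u-ascending j (s≤s z≤n) (s≤s p<) in
            ◁-trans i◁j j◁ , proj₂ (up i j (in₁ (s≤s z≤n)) (in₂ (s≤s z≤n)) (in₂ (s≤s p<)) i◁j j◁)
    ...   | inj₂ j◁i = u j 0 , in₂ (s≤s z≤n) , λ where
          l (inj₂ refl) p< → u-ascending j (s≤s z≤n) (s≤s p<) , refl
          l (inj₁ refl) p< → let i◁ = u-ascending i (s≤s z≤n) (s≤s p<) in
            ◁-trans j◁i i◁ , proj₂ (up i j (in₂ (s≤s z≤n)) (in₁ (s≤s z≤n)) (in₁ (s≤s p<)) j◁i i◁)

    lift : ∀ i j {m} → Root i j m → ∀ {ys} → All (InPair S v i j) ys →
           ∃ λ xs → map (d m) xs ≡ ys × All (m ◁_) xs × All (In i j) xs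
    lift i j ρ [] = [] , refl , [] , []
    lift i j ρ@(_ , r) (inj₁ (p , p< , refl) ∷ ps) =
      let xs , e , ls , is = lift i j ρ ps ; l , e′ = r i (inj₁ refl) p< in
      u i (suc p) ∷ xs , cong₂ _∷_ e′ e , l ∷ ls , in₁ (s≤s p<) ∷ is
    lift i j ρ@(_ , r) (inj₂ (p , p< , refl) ∷ ps) =
      let xs , e , ls , is = lift i j ρ ps ; l , e′ = r j (inj₂ refl) p< in
      u j (suc p) ∷ xs , cong₂ _∷_ e′ e , l ∷ ls , in₂ (s≤s p<) ∷ is

    d-reflects : ∀ i j {m x y} → In i j m → In i j x → In i j y → m ◁ x → m ◁ y →
                 d m x < d m y → x ◁ y
    d-reflects i j {m} {x} {y} m∈ x∈ y∈ m◁x m◁y dx<dy with ◁-total {x} {y} (λ x≡y → <⇒≢ dx<dy (cong (d m) x≡y))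
    ... | inj₁ x◁y = x◁y
    ... | inj₂ y◁x = let l , e = up i j m∈ y∈ x∈ m◁y y◁x in
          contradiction (<-trans dx<dy (subst (d m y <_) (sym e) l)) (<-irrefl refl)

    chain : ∀ i j {m xs} → In i j m → All (m ◁_) xs → All (In i j) xs →
            AllPairs _<_ (map (d m) xs) → AllPairs _◁_ xs
    chain i j m∈ []       []       []       = []
    chain i j m∈ (l ∷ ls) (x ∷ xs) (a ∷ as) =
      All.zipWith (λ ((l′ , x′) , a′) → d-reflects i j m∈ x x′ l l′ a′)
                  (All.zipWith (λ z → z) (ls , xs) , Allₚ.map⁻ a)
      ∷ chain i j m∈ ls xs as

    -- For `m ◁ x ◁ y`, `up` gives `d m y ≡ d x y`: a consecutive difference is the level at which
    -- the later vertex leaves `m`.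
    deltas-root : ∀ i j {m x xs} → In i j m → In i j x → All (In i j) xs → m ◁ x → AllPairs _◁_ (x ∷ xs) →
                  deltas d (x ∷ xs) ≡ map (d m) xs
    deltas-root i j m∈ x∈ []        m◁x _ = refl
    deltas-root i j m∈ x∈ (y∈ ∷ is) m◁x ((x◁y ∷ _) ∷ ps) =
      cong₂ _∷_ (sym (proj₂ (up i j m∈ x∈ y∈ m◁x x◁y)))
                (deltas-root i j m∈ y∈ is (◁-trans m◁x x◁y) ps)

    deltas-root′ : ∀ i j {m xs} → In i j m → All (In i j) xs → All (m ◁_) xs → AllPairs _◁_ xs →
                   deltas d (m ∷ xs) ≡ map (d m) xs
    deltas-root′ i j m∈ []        _         _  = refl
    deltas-root′ i j m∈ (x∈ ∷ is) (m◁x ∷ _) ps = cong (_ ∷_) (deltas-root i j m∈ x∈ is m◁x ps)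

    -- The root is the extra vertex: put in front of the vertices that branch off from it at the
    -- levels `ys`, it forms an edge of the old system whose list of differences is `ys`.
    v-mono : ∀ i j ys → length ys ≡ k → AllPairs _<_ ys → All (InPair S v i j) ys → χ ys ≡ c
    v-mono i j ys len asc ins with root i j
    ... | m , ρ@(m∈ , _) with lift i j ρ ins
    ...   | xs , refl , ls , is = trans (cong χ (sym (deltas-root′ i j m∈ is ls ps)))
             (u-mono i j (m ∷ xs) (cong suc (trans (sym (length-map (d m) xs)) len)) (ls ∷ ps) (m∈ ∷ is))
      where ps = chain i j m∈ ls is asc

    -- Seen from the root, the later of two vertices branches off at a strictly higher level, so
    -- different vertices give different levels.
    v-disjoint : ∀ {i j p q} → i ≢ j → p < S → q < S → v i p ≢ v j q
    v-disjoint {i} {j} {p} {q} i≢j p< q< e with root i j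
    ... | m , m∈ , r with r i (inj₁ refl) p< | r j (inj₂ refl) q<
    ...   | l , e₁ | l′ , e₂ with trans e₁ (trans e (sym e₂)) | ◁-total (u-disjoint i≢j (s≤s p<) (s≤s q<))
    ...     | e₃ | inj₁ i◁j = let h , e₄ = up i j m∈ (in₁ (s≤s p<)) (in₂ (s≤s q<)) l i◁j in
                <⇒≢ h (trans e₃ e₄)
    ...     | e₃ | inj₂ j◁i = let h , e₄ = up i j m∈ (in₂ (s≤s q<)) (in₁ (s≤s p<)) l′ j◁i in
                <⇒≢ h (trans (sym e₃) e₄)

  system : BlockSystem k S χ c N v
  system = record
    { ascending = λ i {p} {q} p<q q< →
        let 0◁ = u-ascending i (s≤s z≤n) (s≤s (<-trans p<q q<)) ; ◁q = u-ascending i (s≤s p<q) (s≤s q<)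
            h , e = up i i (in₁ (s≤s z≤n)) (in₁ (s≤s (<-trans p<q q<))) (in₁ (s≤s q<)) 0◁ ◁q
        in subst (v i p <_) (sym e) h
    ; bounded   = λ i p< → d-bounded i (0 , s≤s z≤n , refl) (_ , s≤s p< , refl) (u-ascending i (s≤s z≤n) (s≤s p<))
    ; disjoint  = v-disjoint
    ; mono      = v-mono
    }

≢⇒<∨> : ∀ {x y} → x ≢ y → x < y ⊎ y < x
≢⇒<∨> {x} {y} x≢y with <-cmp x y
... | tri< l _ _ = inj₁ l
... | tri≈ _ e _ = contradiction e x≢y
... | tri> _ _ g = inj₂ g

module Monotone
  {C : Set} (K k S n : ℕ) (χ : List ℕ → C) (c : C) (u : Fin n → ℕ → ℕ)
  (u-ascending : ∀ i {p q} → p < q → q < suc S → u i p < u i q)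
  (u-bounded : ∀ i {p} → p < suc S → u i p < 2 ^ K)
  (u-disjoint : ∀ {i j p q} → i ≢ j → p < suc S → q < suc S → u i p ≢ u j q)
  where

  private
    In : Fin n → Fin n → ℕ → Set
    In = InPair (suc S) u

    block-bounded : ∀ {i x} → Block (suc S) u i x → x < 2 ^ K
    block-bounded (_ , p< , refl) = u-bounded _ p<

    in-bounded : ∀ {i j x} → In i j x → x < 2 ^ K
    in-bounded = [ block-bounded , block-bounded ]

  increasing-system :
    (∀ i j {x y z} → In i j x → In i j y → In i j z → x < y → y < z → δ K x y < δ K y z) →
    (∀ i j xs → length xs ≡ suc k → AllPairs _<_ xs → All (In i j) xs → χ (deltas (δ K) xs) ≡ c) →
    ∃ λ v → BlockSystem k S χ c K {n} v
  increasing-system inc mono = _ , system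
    where
    up : ∀ i j {x y z} → In i j x → In i j y → In i j z → x < y → y < z →
         δ K x y < δ K y z × δ K x z ≡ δ K y z
    up i j x∈ y∈ z∈ x<y y<z with δ-ultra K x<y y<z (in-bounded z∈)
    ... | inj₁ r       = r
    ... | inj₂ (l , _) = contradiction (<-trans l (inc i j x∈ y∈ z∈ x<y y<z)) (<-irrefl refl)

    open Descent {N = K} χ c _<_ <-trans ≢⇒<∨> (δ K) u u-ascending u-disjoint up
      (λ i x∈ y∈ x<y → δ-< K x<y (block-bounded y∈)) mono

  -- Along ascending vertices the levels now descend, and `reverse` puts them into the ascending
  -- order in which χ expects its argument. Reading vertices and blocks from the top reduces this to
  -- the increasing case.
  decreasing-system :
    (∀ i j {x y z} → In i j x → In i j y → In i j z → x < y → y < z → δ K y z < δ K x y) →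
    (∀ i j xs → length xs ≡ suc k → AllPairs _<_ xs → All (In i j) xs → χ (reverse (deltas (δ K) xs)) ≡ c) →
    ∃ λ v → BlockSystem k S χ c K {n} v
  decreasing-system dec mono = _ , system
    where
    r : Fin n → ℕ → ℕ
    r i p = u i (S ∸ p)

    block-r : ∀ {i x} → Block (suc S) r i x → Block (suc S) u i x
    block-r (p , _ , e) = S ∸ p , s≤s (m∸n≤m S p) , e

    in-r : ∀ {i j x} → InPair (suc S) r i j x → In i j x
    in-r = Sum.map block-r block-r

    up : ∀ i j {x y z} → InPair (suc S) r i j x → InPair (suc S) r i j y → InPair (suc S) r i j z →
         x > y → y > z → δ K x y < δ K y z × δ K x z ≡ δ K y z
    up i j {x} {y} {z} x∈ y∈ z∈ y<x z<y
      rewrite δ-sym K x y | δ-sym K y z | δ-sym K x z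
      with δ-ultra K z<y y<x (in-bounded (in-r x∈))
    ... | inj₂ q       = q
    ... | inj₁ (l , _) = contradiction (<-trans l (dec i j (in-r z∈) (in-r y∈) (in-r x∈) z<y y<x)) (<-irrefl refl)

    mono′ : ∀ i j xs → length xs ≡ suc k → AllPairs _>_ xs → All (InPair (suc S) r i j) xs →
            χ (deltas (δ K) xs) ≡ c
    mono′ i j xs len ps ins = trans (cong χ (begin
        deltas (δ K) xs                        ≡⟨ reverse-involutive _ ⟨
        reverse (reverse (deltas (δ K) xs))    ≡⟨ cong reverse (deltas-reverse (δ K) (δ-sym K) xs) ⟨
        reverse (deltas (δ K) (reverse xs))    ∎))
      (mono i j (reverse xs) (trans (length-reverse xs) len) (AllPairs-reverse ps)
            (All.map in-r (All-resp-↭ (↭-sym (↭-reverse xs)) ins)))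
      where open ≡-Reasoning

    open Descent {N = K} χ c _>_ (flip <-trans) (Sum.swap ∘ ≢⇒<∨>) (δ K) r
      (λ i {p} p<q q< → u-ascending i (∸-monoʳ-< p<q (≤-pred q<)) (s≤s (m∸n≤m S p)))
      (λ {_} {_} {p} {q} i≢j _ _ → u-disjoint i≢j (s≤s (m∸n≤m S p)) (s≤s (m∸n≤m S q)))
      up
      (λ i {x} {y} x∈ y∈ y<x → subst (_< K) (δ-sym K y x) (δ-< K y<x (block-bounded (block-r x∈))))
      mono′

-- Stepping up from pairs to triples

rising : ℕ → ℕ → ℕ → ℕ → Bool
rising K x y z = δ K x y <ᵇ δ K y z

rising⇒< : ∀ K {x y z} → rising K x y z ≡ true → δ K x y < δ K y z
rising⇒< K {x} {y} {z} e = <ᵇ⇒< (δ K x y) (δ K y z) (subst T (sym e) tt)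

¬rising⇒> : ∀ K {x y z} → x < y → y < z → z < 2 ^ K → rising K x y z ≡ false → δ K y z < δ K x y
¬rising⇒> K x<y y<z z< e with δ-ultra K x<y y<z z<
... | inj₁ (l , _) = ⊥-elim (subst T e (<⇒<ᵇ l))
... | inj₂ (l , _) = l

encode : Bool → Bool → Fin 4
encode true  true  = 0F
encode true  false = 1F
encode false true  = 2F
encode false false = 3F

decode : Fin 4 → Bool × Bool
decode 0F = true  , true
decode 1F = true  , false
decode 2F = false , true
decode 3F = false , false

decode-encode : ∀ a b → decode (encode a b) ≡ (a , b)
decode-encode true  true  = refl
decode-encode true  false = refl
decode-encode false true  = refl
decode-encode false false = refl

orient : Bool → List ℕ → List ℕ
orient up ds = if up then ds else reverse ds

stepUp₂ : ℕ → (List ℕ → Bool) → List ℕ → Fin 4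
stepUp₂ K χ xs@(x ∷ y ∷ z ∷ []) = encode (rising K x y z) (χ (orient (rising K x y z) (deltas (δ K) xs)))
stepUp₂ K χ _                   = 0F

-- The sign and the colour for pairs are both decoded from `c`. One vertex per block is lost because
-- levels are measured from an extreme vertex of the block.
stepUp₂-descends : ∀ {K S n χ c b} → BlockSystem 3 (suc S) (stepUp₂ K χ) c (2 ^ K) {n} b →
                   ∃ λ c′ → ∃ λ v → BlockSystem 2 S χ c′ K {n} v
stepUp₂-descends {K} {S} {n} {χ} {c} {b} B = proj₂ (decode c) , result (proj₁ (decode c)) refl
  where
  open BlockSystem B
  open Monotone K 2 S n χ (proj₂ (decode c)) b ascending bounded disjoint

  triple : ∀ i j {x y z} → InPair (suc S) b i j x → InPair (suc S) b i j y → InPair (suc S) b i j z →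
           x < y → y < z →
           (rising K x y z , χ (orient (rising K x y z) (deltas (δ K) (x ∷ y ∷ z ∷ [])))) ≡ decode c
  triple i j x∈ y∈ z∈ x<y y<z = trans (sym (decode-encode _ _)) (cong decode
    (mono i j _ refl ((x<y ∷ <-trans x<y y<z ∷ []) ∷ (y<z ∷ []) ∷ [] ∷ []) (x∈ ∷ y∈ ∷ z∈ ∷ [])))

  in-bounded : ∀ {i j x} → InPair (suc S) b i j x → x < 2 ^ K
  in-bounded (inj₁ (_ , p< , refl)) = bounded _ p<
  in-bounded (inj₂ (_ , p< , refl)) = bounded _ p<

  colour : ∀ s → proj₁ (decode c) ≡ s → ∀ i j xs → length xs ≡ 3 → AllPairs _<_ xs →
           All (InPair (suc S) b i j) xs → χ (orient s (deltas (δ K) xs)) ≡ proj₂ (decode c)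
  colour s e i j (x ∷ y ∷ z ∷ []) refl ((x<y ∷ _) ∷ (y<z ∷ _) ∷ _) (x∈ ∷ y∈ ∷ z∈ ∷ []) =
    let eq = triple i j x∈ y∈ z∈ x<y y<z in
    trans (cong (λ t → χ (orient t (deltas (δ K) (x ∷ y ∷ z ∷ [])))) (sym (trans (cong proj₁ eq) e))) (cong proj₂ eq)

  result : ∀ s → proj₁ (decode c) ≡ s → ∃ λ v → BlockSystem 2 S χ (proj₂ (decode c)) K {n} v
  result true  e = increasing-system
    (λ i j x∈ y∈ z∈ x<y y<z → rising⇒< K (trans (cong proj₁ (triple i j x∈ y∈ z∈ x<y y<z)) e)) (colour true e)
  result false e = decreasing-system
    (λ i j x∈ y∈ z∈ x<y y<z → ¬rising⇒> K x<y y<z (in-bounded z∈)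
      (trans (cong proj₁ (triple i j x∈ y∈ z∈ x<y y<z)) e)) (colour false e)

-- Stepping up from uniformity at least three

select : ∀ m a b → m ≡ a + b → (t : Fin m → Bool) →
         (∃ λ (g : Fin a → Fin m) → (∀ {i j} → g i ≡ g j → i ≡ j) × ∀ i → t (g i) ≡ true) ⊎
         (∃ λ (g : Fin b → Fin m) → (∀ {i j} → g i ≡ g j → i ≡ j) × ∀ i → t (g i) ≡ false)
select m zero b e t = inj₁ ((λ ()) , (λ { {()} }) , λ ())
select m (suc a) zero e t = inj₂ ((λ ()) , (λ { {()} }) , λ ())
select (suc m) (suc a) (suc b) e t with t zero in eq
... | true  with select m a (suc b) (suc-injective e) (t ∘ suc)
...   | inj₁ (g , g-inj , tg) = inj₁ (g′ , inj′ , λ { zero → eq ; (suc i) → tg i })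
  where
  g′ : Fin (suc a) → Fin (suc m)
  g′ zero    = zero
  g′ (suc i) = suc (g i)
  inj′ : ∀ {i j} → g′ i ≡ g′ j → i ≡ j
  inj′ {zero}  {zero}  _  = refl
  inj′ {suc i} {suc j} e′ = cong suc (g-inj (Finₚ.suc-injective e′))
...   | inj₂ (g , g-inj , tg) = inj₂ (suc ∘ g , (λ e′ → g-inj (Finₚ.suc-injective e′)) , tg)
select (suc m) (suc a) (suc b) e t | false with select m (suc a) b (trans (suc-injective e) (+-suc a b)) (t ∘ suc)
...   | inj₁ (g , g-inj , tg) = inj₁ (suc ∘ g , (λ e′ → g-inj (Finₚ.suc-injective e′)) , tg)
...   | inj₂ (g , g-inj , tg) = inj₂ (g′ , inj′ , λ { zero → eq ; (suc i) → tg i })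
  where
  g′ : Fin (suc b) → Fin (suc m)
  g′ zero    = zero
  g′ (suc i) = suc (g i)
  inj′ : ∀ {i j} → g′ i ≡ g′ j → i ≡ j
  inj′ {zero}  {zero}  _  = refl
  inj′ {suc i} {suc j} e′ = cong suc (g-inj (Finₚ.suc-injective e′))

-- A local maximum gets colour 0 and a local minimum colour 1, so that a monochromatic system
-- cannot have both.
signColour : Bool → Bool → Fin 4 → Fin 4 → Fin 4
signColour true  true  a b = a
signColour true  false a b = 0F
signColour false true  a b = 1F
signColour false false a b = b

-- Only the first three differences decide whether χ is consulted. If these are monotone, χ receives
-- the whole list whatever its later signs; the descent uses such edges only where all signs are
-- known to agree.
stepUp : ℕ → (List ℕ → Fin 4) → List ℕ → Fin 4
stepUp K χ xs@(x ∷ y ∷ z ∷ w ∷ _) =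
  signColour (rising K x y z) (rising K y z w) (χ (deltas (δ K) xs)) (χ (reverse (deltas (δ K) xs)))
stepUp K χ _ = 0F

signColour-no-min : ∀ s t {a b} → signColour s t a b ≢ 1F → t ≡ true → s ≡ true
signColour-no-min true  true h _ = refl
signColour-no-min false true h _ = contradiction refl h

signColour-no-max : ∀ s t {a b} → signColour s t a b ≢ 0F → s ≡ true → t ≡ true
signColour-no-max true true  h _ = refl
signColour-no-max true false h _ = contradiction refl h

-- A block is a front of S + 1 vertices, three middle vertices, a back of S + 1 vertices, and, beyond
-- the core, j vertices that serve only to complete edges.
core : ℕ → ℕ
core S = suc S + (3 + suc S)

stepUp-descends : ∀ {K S j n χ c b} → BlockSystem (4 + j) (core S + j) (stepUp K χ) c (2 ^ K) {n + n} b →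
                  ∃ λ v → BlockSystem (3 + j) S χ c K {n} v
stepUp-descends {K} {S} {j} {n} {χ} {c} {b} B = result
  where
  open BlockSystem B

  In : Fin (n + n) → Fin (n + n) → ℕ → Set
  In = InPair (core S) b

  core≤ : ∀ {p} → p < core S → p < core S + j
  core≤ p< = m≤n⇒m≤n+o j p<

  block-bounded : ∀ {l x} → Block (core S) b l x → x < 2 ^ K
  block-bounded (_ , p< , refl) = bounded _ (core≤ p<)

  in-wide : ∀ {l l′ x} → In l l′ x → InPair (core S + j) b l l′ x
  in-wide = Sum.map (λ (p , p< , e) → p , core≤ p< , e) (λ (p , p< , e) → p , core≤ p< , e)

  tail : Fin (n + n) → List ℕ
  tail l = applyUpTo (λ t → b l (core S + t)) j

  tail-ascending : ∀ l → AllPairs _<_ (tail l)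
  tail-ascending l = AllPairsₚ.applyUpTo⁺₁ _ j λ s<t t< → ascending l (+-monoʳ-< (core S) s<t) (+-monoʳ-< (core S) t<)

  tail-above : ∀ {l x} → Block (core S) b l x → All (x <_) (tail l)
  tail-above {l} (p , p< , refl) = Allₚ.applyUpTo⁺₁ _ j λ {t} t< →
    ascending l (<-≤-trans p< (m≤m+n (core S) t)) (+-monoʳ-< (core S) t<)

  tail-in : ∀ l → All (Block (core S + j) b l) (tail l)
  tail-in l = Allₚ.applyUpTo⁺₁ _ j λ t< → _ , +-monoʳ-< (core S) t< , refl

  tail-above-in : ∀ l l′ {w} → In l l′ w → ∃ λ xs → length xs ≡ j × AllPairs _<_ xs × All (w <_) xs ×
                All (InPair (core S + j) b l l′) xs
  tail-above-in l l′ (inj₁ w∈) = tail l , length-applyUpTo _ j , tail-ascending l , tail-above w∈ , All.map inj₁ (tail-in l)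
  tail-above-in l l′ (inj₂ w∈) = tail l′ , length-applyUpTo _ j , tail-ascending l′ , tail-above w∈ , All.map inj₂ (tail-in l′)

  -- An edge has `4 + j` vertices, but only its first four matter for the signs. The tail of the
  -- block that contains `w` lies above `w`, so it completes the quadruple to an edge of the system
  -- that starts with `x`, `y`, `z`, `w`.
  quadruple : ∀ l l′ {x y z w} → In l l′ x → In l l′ y → In l l′ z → In l l′ w → x < y → y < z → z < w →
              ∃ λ a → ∃ λ a′ → signColour (rising K x y z) (rising K y z w) a a′ ≡ c
  quadruple l l′ x∈ y∈ z∈ w∈ x<y y<z z<w =
    let xs , len , asc , above , ins = tail-above-in l l′ w∈
        y<w = <-trans y<z z<w
        x<w = <-trans x<y y<w
        below : ∀ {v} → v < _ → All (v <_) xs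
        below v<w = All.map (<-trans v<w) above
    in _ , _ , mono l l′ (_ ∷ _ ∷ _ ∷ _ ∷ xs) (cong (4 +_) len)
         ((x<y ∷ <-trans x<y y<z ∷ x<w ∷ below x<w) ∷ (y<z ∷ y<w ∷ below y<w) ∷ (z<w ∷ below z<w) ∷ above ∷ asc)
         (in-wide x∈ ∷ in-wide y∈ ∷ in-wide z∈ ∷ in-wide w∈ ∷ ins)

  -- `Backward` excludes local minima of δ, `Forward` local maxima.
  Backward Forward : Set
  Backward = ∀ l l′ {x y z w} → In l l′ x → In l l′ y → In l l′ z → In l l′ w → x < y → y < z → z < w →
             rising K y z w ≡ true → rising K x y z ≡ true
  Forward  = ∀ l l′ {x y z w} → In l l′ x → In l l′ y → In l l′ z → In l l′ w → x < y → y < z → z < w →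
             rising K x y z ≡ true → rising K y z w ≡ true

  -- The colours 0 and 1 are also values of χ, so `c` does not tell which edges are local extrema.
  -- It still excludes one kind: local minima unless `c` is 1, and local maxima if it is.
  backward-or-forward : Backward ⊎ Forward
  backward-or-forward with c Finₚ.≟ 1F
  ... | no c≢1 = inj₁ λ l l′ x∈ y∈ z∈ w∈ x<y y<z z<w →
        let _ , _ , e = quadruple l l′ x∈ y∈ z∈ w∈ x<y y<z z<w in
        signColour-no-min _ _ (λ e′ → c≢1 (trans (sym e) e′))
  ... | yes c≡1 = inj₂ λ l l′ x∈ y∈ z∈ w∈ x<y y<z z<w →
        let _ , _ , e = quadruple l l′ x∈ y∈ z∈ w∈ x<y y<z z<w in
        signColour-no-max _ _ (λ e′ → case trans (sym c≡1) (trans (sym e) e′) of λ ())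

  m : ℕ
  m = suc S

  middle : Fin (n + n) → Bool
  middle l = rising K (b l m) (b l (1 + m)) (b l (2 + m))

  mid< : ∀ t → t < 3 → t + m < core S
  mid< t t<3 = subst (_< core S) (+-comm m t) (+-monoʳ-< m (m≤n⇒m≤n+o m t<3))

  mid∈ : ∀ t → t < 3 → ∀ l → Block (core S) b l (b l (t + m))
  mid∈ t t<3 l = t + m , mid< t t<3 , refl

  0<3 : 0 < 3
  0<3 = s≤s z≤n
  1<3 : 1 < 3
  1<3 = s≤s (s≤s z≤n)
  2<3 : 2 < 3
  2<3 = s≤s (s≤s (s≤s z≤n))

  mid₀₁ : ∀ l → b l m < b l (1 + m)
  mid₀₁ l = ascending l ≤-refl (core≤ (mid< 1 1<3))
  mid₁₂ : ∀ l → b l (1 + m) < b l (2 + m)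
  mid₁₂ l = ascending l ≤-refl (core≤ (mid< 2 2<3))

  front< : ∀ {l x} → Block (suc S) b l x → x < b l m
  front< (p , p< , refl) = ascending _ p< (core≤ (mid< 0 0<3))

  back : Fin (n + n) → ℕ → ℕ
  back l p = b l (3 + m + p)

  back-pos : ∀ {p} → p < suc S → 3 + m + p < core S
  back-pos {p} p< = subst (3 + m + p <_) (+-comm (3 + m) m)
                      (+-monoʳ-< (3 + m) p<)

  <back : ∀ {l x} → Block (suc S) back l x → b l (2 + m) < x
  <back {l} (p , p< , refl) = ascending l (m≤m+n (3 + m) p) (core≤ (back-pos p<))

  front-in : ∀ {l x} → Block (suc S) b l x → Block (core S) b l x
  front-in (p , p< , e) = p , m≤n⇒m≤n+o (3 + m) p< , e

  back-in : ∀ {l x} → Block (suc S) back l x → Block (core S) b l x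
  back-in (p , p< , e) = _ , back-pos p< , e

  -- If z lies in a front, the middle of its block comes after x, y, z.
  module Front (l l′ : Fin (n + n)) {x y z} (x<y : x < y) (y<z : y < z) where
    module _ (h : Fin (n + n)) (block-h : ∀ {v} → Block (core S) b h v → In l l′ v)
             (x∈ : In l l′ x) (y∈ : In l l′ y) (z∈h : Block (suc S) b h z) where
      z∈ : In l l′ z
      z∈ = block-h (front-in z∈h)
      m₀ = block-h (mid∈ 0 0<3 h)
      m₁ = block-h (mid∈ 1 1<3 h)
      m₂ = block-h (mid∈ 2 2<3 h)

      -- The sign travels along `x < y < z < m₀ < m₁ < m₂` one vertex at a time, from the last three
      -- to the first three; each move is one quadruple.
      pull : Backward → middle h ≡ true → rising K x y z ≡ true
      pull A e = A l l′ x∈ y∈ z∈ m₀ x<y y<z (front< z∈h)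
        (A l l′ y∈ z∈ m₀ m₁ y<z (front< z∈h) (mid₀₁ h)
        (A l l′ z∈ m₀ m₁ m₂ (front< z∈h) (mid₀₁ h) (mid₁₂ h) e))

      push : Forward → rising K x y z ≡ true → middle h ≡ true
      push A e = A l l′ z∈ m₀ m₁ m₂ (front< z∈h) (mid₀₁ h) (mid₁₂ h)
        (A l l′ y∈ z∈ m₀ m₁ y<z (front< z∈h) (mid₀₁ h)
        (A l l′ x∈ y∈ z∈ m₀ x<y y<z (front< z∈h) e))

  module Back (l l′ : Fin (n + n)) {x y z} (x<y : x < y) (y<z : y < z) where
    module _ (h : Fin (n + n)) (block-h : ∀ {v} → Block (core S) b h v → In l l′ v)
             (x∈h : Block (suc S) back h x) (y∈ : In l l′ y) (z∈ : In l l′ z) where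
      x∈ : In l l′ x
      x∈ = block-h (back-in x∈h)
      m₀ = block-h (mid∈ 0 0<3 h)
      m₁ = block-h (mid∈ 1 1<3 h)
      m₂ = block-h (mid∈ 2 2<3 h)

      push : Forward → middle h ≡ true → rising K x y z ≡ true
      push A e = A l l′ m₂ x∈ y∈ z∈ (<back x∈h) x<y y<z
        (A l l′ m₁ m₂ x∈ y∈ (mid₁₂ h) (<back x∈h) x<y
        (A l l′ m₀ m₁ m₂ x∈ (mid₀₁ h) (mid₁₂ h) (<back x∈h) e))

      pull : Backward → rising K x y z ≡ true → middle h ≡ true
      pull A e = A l l′ m₀ m₁ m₂ x∈ (mid₀₁ h) (mid₁₂ h) (<back x∈h)
        (A l l′ m₁ m₂ x∈ y∈ (mid₁₂ h) (<back x∈h) x<y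
        (A l l′ m₂ x∈ y∈ z∈ (<back x∈h) x<y y<z e))

  Part : (ℕ → ℕ) → Set
  Part f = (∀ {p q} → p < q → f p < f q) × (∀ {p} → p < suc S → f p < core S)

  module Selected (f : ℕ → ℕ) (f-part : Part f) (g : Fin n → Fin (n + n)) (g-inj : ∀ {i j} → g i ≡ g j → i ≡ j) where
    u : Fin n → ℕ → ℕ
    u i p = b (g i) (f p)

    u-in : ∀ {i i′ x} → InPair (suc S) u i i′ x → In (g i) (g i′) x
    u-in = Sum.map (λ (p , p< , e) → _ , proj₂ f-part p< , e) (λ (p , p< , e) → _ , proj₂ f-part p< , e)

    open Monotone K (3 + j) S n χ c u
      (λ i p<q q< → ascending (g i) (proj₁ f-part p<q) (core≤ (proj₂ f-part q<)))
      (λ i p< → bounded (g i) (core≤ (proj₂ f-part p<)))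
      (λ i≢i′ p< q< → disjoint (λ e → i≢i′ (g-inj e)) (core≤ (proj₂ f-part p<)) (core≤ (proj₂ f-part q<)))

    Signs : Bool → Set
    Signs s = ∀ i i′ {x y z} → InPair (suc S) u i i′ x → InPair (suc S) u i i′ y → InPair (suc S) u i i′ z →
              x < y → y < z → rising K x y z ≡ s

    edge : ∀ s → Signs s → ∀ i i′ xs → length xs ≡ 4 + j → AllPairs _<_ xs → All (InPair (suc S) u i i′) xs →
           signColour s s (χ (deltas (δ K) xs)) (χ (reverse (deltas (δ K) xs))) ≡ c
    edge s sg i i′ xs@(x ∷ y ∷ z ∷ w ∷ _) len ps@((x<y ∷ _) ∷ (y<z ∷ _) ∷ (z<w ∷ _) ∷ _) ins@(x∈ ∷ y∈ ∷ z∈ ∷ w∈ ∷ _) =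
      trans (sym (cong₂ (λ s t → signColour s t (χ (deltas (δ K) xs)) (χ (reverse (deltas (δ K) xs))))
                 (sg i i′ x∈ y∈ z∈ x<y y<z) (sg i i′ y∈ z∈ w∈ y<z z<w)))
            (mono (g i) (g i′) xs len ps (All.map (in-wide ∘ u-in) ins))

    finish : ∀ s → Signs s → ∃ λ v → BlockSystem (3 + j) S χ c K {n} v
    finish true  sg = increasing-system (λ i i′ x∈ y∈ z∈ x<y y<z → rising⇒< K (sg i i′ x∈ y∈ z∈ x<y y<z)) (edge true sg)
    finish false sg = decreasing-system
      (λ i i′ x∈ y∈ z∈ x<y y<z →
        ¬rising⇒> K x<y y<z ([ block-bounded , block-bounded ] (u-in z∈)) (sg i i′ x∈ y∈ z∈ x<y y<z))
      (edge false sg)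

  front-part : Part (λ p → p)
  front-part = (λ l → l) , m≤n⇒m≤n+o (3 + m)

  back-part : Part (3 + m +_)
  back-part = +-monoʳ-< (3 + m) , back-pos

  ¬true : ∀ {s t} → (s ≡ true → t ≡ true) → t ≡ false → s ≡ false
  ¬true {false} _ _ = refl
  ¬true {true} h e with trans (sym (h refl)) e
  ... | ()

  module _ (g : Fin n → Fin (n + n)) (g-inj : ∀ {i j} → g i ≡ g j → i ≡ j) where
    open module F = Selected (λ p → p) front-part g g-inj using ()
    open module G = Selected (3 + m +_) back-part g g-inj using ()

    front-signs : ∀ s → (∀ l l′ {x y z} (x<y : x < y) (y<z : y < z) h → (∀ {v} → Block (core S) b h v → In l l′ v) →
                         In l l′ x → In l l′ y → Block (suc S) b h z → middle h ≡ s → rising K x y z ≡ s) →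
                  (∀ i → middle (g i) ≡ s) → F.Signs s
    front-signs s H e i i′ x∈ y∈ (inj₁ z∈) x<y y<z = H (g i) (g i′) x<y y<z (g i) inj₁ (F.u-in x∈) (F.u-in y∈) z∈ (e i)
    front-signs s H e i i′ x∈ y∈ (inj₂ z∈) x<y y<z = H (g i) (g i′) x<y y<z (g i′) inj₂ (F.u-in x∈) (F.u-in y∈) z∈ (e i′)

    back-signs : ∀ s → (∀ l l′ {x y z} (x<y : x < y) (y<z : y < z) h → (∀ {v} → Block (core S) b h v → In l l′ v) →
                        Block (suc S) back h x → In l l′ y → In l l′ z → middle h ≡ s → rising K x y z ≡ s) →
                 (∀ i → middle (g i) ≡ s) → G.Signs s
    back-signs s H e i i′ (inj₁ x∈) y∈ z∈ x<y y<z = H (g i) (g i′) x<y y<z (g i) inj₁ x∈ (G.u-in y∈) (G.u-in z∈) (e i)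
    back-signs s H e i i′ (inj₂ x∈) y∈ z∈ x<y y<z = H (g i) (g i′) x<y y<z (g i′) inj₂ x∈ (G.u-in y∈) (G.u-in z∈) (e i′)

    -- Without local minima a rising sign spreads to earlier triples and a falling one to later
    -- triples; without local maxima it is the other way round. Hence fronts serve when the middle
    -- sign spreads to earlier triples, backs when it spreads to later ones.
    choose : ∀ s → (∀ i → middle (g i) ≡ s) → Backward ⊎ Forward → ∃ λ v → BlockSystem (3 + j) S χ c K {n} v
    choose true  e (inj₁ A) = F.finish true (front-signs true
      (λ l l′ x<y y<z h inc x∈ y∈ z∈ → Front.pull l l′ x<y y<z h inc x∈ y∈ z∈ A) e)
    choose false e (inj₁ A) = G.finish false (back-signs false
      (λ l l′ x<y y<z h inc x∈ y∈ z∈ → ¬true (Back.pull l l′ x<y y<z h inc x∈ y∈ z∈ A)) e)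
    choose true  e (inj₂ A) = G.finish true (back-signs true
      (λ l l′ x<y y<z h inc x∈ y∈ z∈ → Back.push l l′ x<y y<z h inc x∈ y∈ z∈ A) e)
    choose false e (inj₂ A) = F.finish false (front-signs false
      (λ l l′ x<y y<z h inc x∈ y∈ z∈ → ¬true (Front.push l l′ x<y y<z h inc x∈ y∈ z∈ A)) e)

  result : ∃ λ v → BlockSystem (3 + j) S χ c K {n} v
  result with select (n + n) n n refl middle
  ... | inj₁ (g , g-inj , e) = choose g g-inj true e backward-or-forward
  ... | inj₂ (g , g-inj , e) = choose g g-inj false e backward-or-forward

-- Random colourings of pairs

ascending-sort : ∀ {xs} → Unique xs → ∃ λ ys → ys ↭ xs × AllPairs _<_ ys
ascending-sort {xs} xs! = sort xs , sort-↭ xs ,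
  AllPairs.zipWith (λ (x≤y , x≢y) → ≤∧≢⇒< x≤y x≢y)
    ( Sorted⇒AllPairs ≤-totalOrder (sort-↗ xs)
    , Permutationₚ.Unique-resp-↭ (setoid ℕ) (↭⇒↭ₛ (↭-sym (sort-↭ xs))) xs! )

length-cartesianProductWith : ∀ {A B C : Set} (f : A → B → C) xs ys →
                              length (cartesianProductWith f xs ys) ≡ length xs * length ys
length-cartesianProductWith f []       ys = refl
length-cartesianProductWith f (x ∷ xs) ys = trans (length-++ (map (f x) ys))
  (cong₂ _+_ (length-map (f x) ys) (length-cartesianProductWith f xs ys))

fromList : ∀ {n} → List (Fin n) → Subset n
fromList []       = ⊥
fromList (x ∷ xs) = ⁅ x ⁆ ∪ fromList xs

∈-fromList⁻ : ∀ {n} {x : Fin n} xs → x ∈ fromList xs → x List.∈ xs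
∈-fromList⁻ []       x∈ = ⊥-elim (Subsetₚ.∉⊥ x∈)
∈-fromList⁻ (y ∷ xs) x∈ with Subsetₚ.x∈p∪q⁻ ⁅ y ⁆ (fromList xs) x∈
... | inj₁ x∈y = here (Subsetₚ.x∈⁅y⁆⇒x≡y y x∈y)
... | inj₂ x∈′ = there (∈-fromList⁻ xs x∈′)

∈-fromList⁺ : ∀ {n} {x : Fin n} {xs} → x List.∈ xs → x ∈ fromList xs
∈-fromList⁺ (here refl) = Subsetₚ.x∈p∪q⁺ (inj₁ (Subsetₚ.x∈⁅x⁆ _))
∈-fromList⁺ (there x∈)  = Subsetₚ.x∈p∪q⁺ (inj₂ (∈-fromList⁺ x∈))

∣⁅x⁆∪p∣ : ∀ {n} (x : Fin n) p → x ∉ p → ∣ ⁅ x ⁆ ∪ p ∣ ≡ suc ∣ p ∣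
∣⁅x⁆∪p∣ zero    (inside  ∷ p) x∉ = contradiction here x∉
∣⁅x⁆∪p∣ zero    (outside ∷ p) x∉ = cong (suc ∘ ∣_∣) (Subsetₚ.∪-identityˡ p)
∣⁅x⁆∪p∣ (suc x) (inside  ∷ p) x∉ = cong suc (∣⁅x⁆∪p∣ x p (x∉ ∘ there))
∣⁅x⁆∪p∣ (suc x) (outside ∷ p) x∉ = ∣⁅x⁆∪p∣ x p (x∉ ∘ there)

∣fromList∣ : ∀ {n} {xs : List (Fin n)} → Unique xs → ∣ fromList xs ∣ ≡ length xs
∣fromList∣ {n} []  = Subsetₚ.∣⊥∣≡0 n
∣fromList∣ {xs = x ∷ xs} (x∉ ∷ xs!) =
  trans (∣⁅x⁆∪p∣ x (fromList xs) (λ x∈ → All.lookup x∉ (∈-fromList⁻ xs x∈) refl)) (cong suc (∣fromList∣ xs!))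

-- The number of Boolean vectors with prescribed entries on `p`, that is 2 to the power n - ∣p∣, by
-- a recursion that matches fixing one entry at a time.
weight : ∀ {n} → Subset n → ℕ
weight []            = 1
weight (inside  ∷ p) = weight p
weight (outside ∷ p) = weight p + weight p

weight-card : ∀ {n} (p : Subset n) → weight p * 2 ^ ∣ p ∣ ≡ 2 ^ n
weight-card []            = refl
weight-card {suc n} (inside  ∷ p) = begin
  weight p * (2 * 2 ^ ∣ p ∣)   ≡⟨ lemma (weight p) (2 ^ ∣ p ∣) ⟩
  2 * (weight p * 2 ^ ∣ p ∣)   ≡⟨ cong (2 *_) (weight-card p) ⟩
  2 * 2 ^ n                    ∎
  where open ≡-Reasoning
        lemma : ∀ a b → a * (2 * b) ≡ 2 * (a * b)
        lemma = solve-∀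
weight-card {suc n} (outside ∷ p) = begin
  (weight p + weight p) * 2 ^ ∣ p ∣   ≡⟨ lemma (weight p) (2 ^ ∣ p ∣) ⟩
  2 * (weight p * 2 ^ ∣ p ∣)          ≡⟨ cong (2 *_) (weight-card p) ⟩
  2 * 2 ^ n                           ∎
  where open ≡-Reasoning
        lemma : ∀ a b → (a + a) * b ≡ 2 * (a * b)
        lemma = solve-∀

total : ∀ {n} → List (Subset n × Bool) → ℕ
total cs = sum (map (weight ∘ proj₁) cs)

Split : ∀ {n} → Vec Bool n → Subset n × Bool → Set
Split v (p , a) = ∃ λ x → x ∈ p × lookup v x ≢ a

-- Conditioning on the first entry: a constraint that this entry already splits disappears, and the
-- others go on with the remaining entries.
restrict : ∀ {n} → Bool → List (Subset (suc n) × Bool) → List (Subset n × Bool)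
restrict b []                       = []
restrict b ((outside ∷ p , a) ∷ cs) = (p , a) ∷ restrict b cs
restrict b ((inside  ∷ p , a) ∷ cs) with b Boolₚ.≟ a
... | yes _ = (p , a) ∷ restrict b cs
... | no  _ = restrict b cs

total-restrict : ∀ {n} (cs : List (Subset (suc n) × Bool)) →
                 total (restrict true cs) + total (restrict false cs) ≡ total cs
total-restrict [] = refl
total-restrict ((outside ∷ p , a) ∷ cs) =
  trans (lemma (weight p) _ _) (cong (weight p + weight p +_) (total-restrict cs))
  where lemma : ∀ a b c → (a + b) + (a + c) ≡ a + a + (b + c)
        lemma = solve-∀
total-restrict ((inside ∷ p , true) ∷ cs) =
  trans (+-assoc (weight p) _ _) (cong (weight p +_) (total-restrict cs))
total-restrict ((inside ∷ p , false) ∷ cs) =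
  trans (lemma (weight p) (total (restrict true cs)) _) (cong (weight p +_) (total-restrict cs))
  where lemma : ∀ a b c → b + (a + c) ≡ a + (b + c)
        lemma = solve-∀

unrestrict : ∀ {n} b (v : Vec Bool n) cs → All (Split v) (restrict b cs) → All (Split (b ∷ v)) cs
unrestrict b v []                       []       = []
unrestrict b v ((outside ∷ p , a) ∷ cs) ((x , x∈ , e) ∷ s) = (suc x , there x∈ , e) ∷ unrestrict b v cs s
unrestrict b v ((inside  ∷ p , a) ∷ cs) s with b Boolₚ.≟ a
unrestrict b v ((inside  ∷ p , a) ∷ cs) ((x , x∈ , e) ∷ s) | yes _ = (suc x , there x∈ , e) ∷ unrestrict b v cs s
unrestrict b v ((inside  ∷ p , a) ∷ cs) s | no b≢a = (zero , here , b≢a) ∷ unrestrict b v cs s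

-- The method of conditional expectations: total cs / 2 ^ n is the expected number of pairs (p , a)
-- such that a uniformly random v is constantly a on p.
splitting-vector : ∀ n (cs : List (Subset n × Bool)) → total cs < 2 ^ n → ∃ λ v → All (Split v) cs
splitting-vector zero    []               _  = [] , []
splitting-vector zero    (([] , _) ∷ cs)  l  = contradiction (≤-pred l) λ ()
splitting-vector (suc n) cs l with total (restrict true cs) <? 2 ^ n
... | yes lt = let v , s = splitting-vector n (restrict true cs) lt in true ∷ v , unrestrict true v cs s
... | no  ¬lt = let v , s = splitting-vector n (restrict false cs) lf in false ∷ v , unrestrict false v cs s
  where
  lf : total (restrict false cs) < 2 ^ n
  lf = +-cancelˡ-< (2 ^ n) _ _ (begin-strict
    2 ^ n + total (restrict false cs)                       ≤⟨ +-monoˡ-≤ _ (≮⇒≥ ¬lt) ⟩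
    total (restrict true cs) + total (restrict false cs)    ≡⟨ total-restrict cs ⟩
    total cs                                                <⟨ l ⟩
    2 ^ n + (2 ^ n + 0)                                     ≡⟨ cong (2 ^ n +_) (+-identityʳ _) ⟩
    2 ^ n + 2 ^ n                                           ∎)
    where open ≤-Reasoning

total-bound : ∀ {n} e (cs : List (Subset n × Bool)) → All (λ c → ∣ proj₁ c ∣ ≡ e) cs →
              total cs * 2 ^ e ≡ length cs * 2 ^ n
total-bound e []             []         = refl
total-bound {n} e ((p , _) ∷ cs) (refl ∷ es) = begin
  (weight p + total cs) * 2 ^ e          ≡⟨ *-distribʳ-+ (2 ^ e) (weight p) (total cs) ⟩
  weight p * 2 ^ e + total cs * 2 ^ e    ≡⟨ cong₂ _+_ (weight-card p) (total-bound e cs es) ⟩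
  2 ^ n + length cs * 2 ^ n              ∎
  where open ≡-Reasoning

module _ {N : ℕ} where

  -- A colouring has one bit for each ordered pair, `N * N` in all. An ascending list produces each
  -- of its pairs once, with the smaller vertex first, and this is the bit that `lookupPair` reads
  -- for an edge.
  pairs : List (Fin N) → List (Fin (N * N))
  pairs []       = []
  pairs (x ∷ xs) = map (combine x) xs ++ pairs xs

  ∈-pairs⁻ : ∀ {R : Fin N → Fin N → Set} {xs} → AllPairs R xs → ∀ {i} → i List.∈ pairs xs →
             ∃ λ x → ∃ λ y → x List.∈ xs × y List.∈ xs × R x y × i ≡ combine x y
  ∈-pairs⁻ {xs = x ∷ xs} (px ∷ ps) i∈ with ∈-++⁻ (map (combine x) xs) i∈
  ... | inj₁ i∈′ = let y , y∈ , e = ∈-map⁻ (combine x) i∈′ in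
                   x , y , here refl , there y∈ , All.lookup px y∈ , e
  ... | inj₂ i∈′ = let x′ , y′ , x∈ , y∈ , r , e = ∈-pairs⁻ ps i∈′ in
                   x′ , y′ , there x∈ , there y∈ , r , e

  pairs-unique : ∀ {xs} → Unique xs → Unique (pairs xs)
  pairs-unique []                     = []
  pairs-unique {x ∷ xs} (x∉ ∷ xs!) = Uniqueₚ.++⁺
    (Uniqueₚ.map⁺ (λ {y} {z} → Finₚ.combine-injectiveʳ x y x z) xs!)
    (pairs-unique xs!)
    λ (i∈ , i∈′) → let y , _ , e = ∈-map⁻ (combine x) i∈
                       x′ , y′ , x′∈ , _ , _ , e′ = ∈-pairs⁻ xs! i∈′
                   in All.lookup x∉ x′∈ (Finₚ.combine-injectiveˡ x y x′ y′ (trans (sym e) e′))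

  length-pairs : ∀ xs → 2 * length (pairs xs) + length xs ≡ length xs * length xs
  length-pairs []       = refl
  length-pairs (x ∷ xs) = begin
    2 * length (map (combine x) xs ++ pairs xs) + suc l   ≡⟨ cong (λ h → 2 * h + suc l) length-step ⟩
    2 * (l + length (pairs xs)) + suc l                   ≡⟨ lemma l (length (pairs xs)) ⟩
    (2 * length (pairs xs) + l) + (1 + 2 * l)             ≡⟨ cong (_+ (1 + 2 * l)) (length-pairs xs) ⟩
    l * l + (1 + 2 * l)                                   ≡⟨ lemma′ l ⟩
    suc l * suc l                                         ∎
    where
    open ≡-Reasoning
    l = length xs
    length-step : length (map (combine x) xs ++ pairs xs) ≡ l + length (pairs xs)
    length-step = trans (length-++ (map (combine x) xs)) (cong (_+ _) (length-map (combine x) xs))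
    lemma : ∀ a b → 2 * (a + b) + suc a ≡ (2 * b + a) + (1 + 2 * a)
    lemma = solve-∀
    lemma′ : ∀ a → a * a + (1 + 2 * a) ≡ suc a * suc a
    lemma′ = solve-∀

  tuples : ℕ → List (List (Fin N))
  tuples zero    = [] ∷ []
  tuples (suc l) = cartesianProductWith _∷_ (allFin N) (tuples l)

  length-tuples : ∀ l → length (tuples l) ≡ N ^ l
  length-tuples zero    = refl
  length-tuples (suc l) = trans (length-cartesianProductWith _∷_ (allFin N) (tuples l))
    (cong₂ _*_ (length-tabulate {n = N} (λ i → i)) (length-tuples l))

  ∈-tuples : ∀ xs → xs List.∈ tuples (length xs)
  ∈-tuples []       = here refl
  ∈-tuples (x ∷ xs) = ∈-cartesianProductWith⁺ _∷_ (∈-allFin x) (∈-tuples xs)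

lookupPair : ∀ N → Vec Bool (N * N) → List ℕ → Bool
lookupPair N v (x ∷ y ∷ []) with x <? N | y <? N
... | yes x< | yes y< = lookup v (combine (fromℕ< x<) (fromℕ< y<))
... | _      | _      = false
lookupPair N v _             = false

lookupPair-toℕ : ∀ {N} (v : Vec Bool (N * N)) (x y : Fin N) →
                 lookupPair N v (toℕ x ∷ toℕ y ∷ []) ≡ lookup v (combine x y)
lookupPair-toℕ {N} v x y with toℕ x <? N | toℕ y <? N
... | yes x< | yes y< = cong₂ (λ i j → lookup v (combine i j)) (Finₚ.fromℕ<-toℕ x x<) (Finₚ.fromℕ<-toℕ y y<)
... | no x≮  | _      = contradiction (Finₚ.toℕ<n x) x≮
... | yes _  | no y≮  = contradiction (Finₚ.toℕ<n y) y≮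

toFinList : ∀ {N xs} → All (_< N) xs → ∃ λ (zs : List (Fin N)) → map toℕ zs ≡ xs
toFinList []        = [] , refl
toFinList (x< ∷ ps) = let zs , e = toFinList ps in fromℕ< x< ∷ zs , cong₂ _∷_ (Finₚ.toℕ-fromℕ< x<) e

PairColouring : ℕ → ℕ → Set
PairColouring N L = ∃ λ (χ : List ℕ → Bool) → ∀ c b → ¬ BlockSystem 2 1 χ c N {L} b

-- The equation says that `e` is the number of pairs among `L` vertices. The inequality is the union
-- bound of Erdős, with the sets of `L` vertices overcounted by the `N ^ L` tuples.
random-pair-colouring : ∀ N L e → 2 * e + L ≡ L * L → 2 * N ^ L < 2 ^ e → PairColouring N L
random-pair-colouring N L e tri few = lookupPair N v , avoids
  where
  M = N * N
  isFull? : ∀ (p : Subset M × Bool) → Dec (∣ proj₁ p ∣ ≡ e)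
  isFull? (p , _) = ∣ p ∣ ≟ e

  candidates constraints : List (Subset M × Bool)
  candidates  = cartesianProduct (map (fromList ∘ pairs) (tuples L)) (true ∷ false ∷ [])
  -- Tuples with repetitions can have fewer than `e` pairs. Keeping only the sets of size `e` gives
  -- all constraints the same weight, as `total-bound` requires.
  constraints = filter isFull? candidates

  length-constraints : length constraints ≤ 2 * N ^ L
  length-constraints = begin
    length constraints                                 ≤⟨ length-filter isFull? candidates ⟩
    length candidates                                  ≡⟨ length-cartesianProductWith _,_ (map (fromList ∘ pairs) (tuples L)) _ ⟩
    length (map (fromList ∘ pairs) (tuples {N} L)) * 2 ≡⟨ cong (_* 2) (trans (length-map _ (tuples L)) (length-tuples L)) ⟩
    N ^ L * 2                                          ≡⟨ *-comm (N ^ L) 2 ⟩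
    2 * N ^ L                                          ∎
    where open ≤-Reasoning

  small : total constraints < 2 ^ M
  small = *-cancelʳ-< (2 ^ e) (total constraints) (2 ^ M) (begin-strict
    total constraints * 2 ^ e     ≡⟨ total-bound e constraints (Allₚ.all-filter isFull? candidates) ⟩
    length constraints * 2 ^ M    ≤⟨ *-monoˡ-≤ (2 ^ M) length-constraints ⟩
    2 * N ^ L * 2 ^ M             <⟨ *-monoˡ-< (2 ^ M) {{m^n≢0 2 M}} few ⟩
    2 ^ e * 2 ^ M                 ≡⟨ *-comm (2 ^ e) (2 ^ M) ⟩
    2 ^ M * 2 ^ e                 ∎)
    where open ≤-Reasoning

  v : Vec Bool M
  v = proj₁ (splitting-vector M constraints small)

  split : All (Split v) constraints
  split = proj₂ (splitting-vector M constraints small)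

  -- With one vertex per block, two blocks span one pair, and the system is a monochromatic clique
  -- on `L` vertices. Sorted, it is one of the tuples, so its set of pairs is among the constraints.
  avoids : ∀ c b → ¬ BlockSystem 2 1 (lookupPair N v) c N {L} b
  avoids c b B with ascending-sort {map (λ i → b i 0) (allFin L)}
    (Uniqueₚ.map⁺ (λ {i} {j} e → case i Finₚ.≟ j of λ where
       (yes i≡j) → i≡j
       (no i≢j) → contradiction e (BlockSystem.disjoint B i≢j (s≤s z≤n) (s≤s z≤n))) (Uniqueₚ.allFin⁺ L))
  ... | ys , ys↭ , ys-asc with toFinList {N} {ys} (All-resp-↭ (↭-sym ys↭) (Allₚ.map⁺ (Allₚ.tabulate⁺ λ i → BlockSystem.bounded B i (s≤s z≤n))))
  ... | zs , refl = unsplit (All.lookup split (∈-filter⁺ isFull?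
            (∈-cartesianProduct⁺ (∈-map⁺ (fromList ∘ pairs) (subst (λ l → zs List.∈ tuples l) len (∈-tuples zs))) (c∈ c))
            full))
    where
    c∈ : ∀ c → c List.∈ (true ∷ false ∷ [])
    c∈ true  = here refl
    c∈ false = there (here refl)

    len : length zs ≡ L
    len = trans (sym (length-map toℕ zs)) (trans (↭-length ys↭) (trans (length-map _ (allFin L)) (length-tabulate {n = L} (λ i → i))))

    zs-asc : AllPairs Fin._<_ zs
    zs-asc = AllPairsₚ.map⁻ ys-asc

    full : ∣ fromList (pairs zs) ∣ ≡ e
    full = trans (∣fromList∣ (pairs-unique (AllPairs.map Finₚ.<⇒≢ zs-asc)))
      (*-cancelˡ-≡ _ _ 2 (+-cancelʳ-≡ L _ _ (trans (trans (cong (_ +_) (sym len)) (length-pairs zs))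
        (trans (cong₂ _*_ len len) (sym tri)))))

    member : ∀ {x} → x List.∈ zs → ∃ λ i → Block 1 b i (toℕ x)
    member x∈ = let i , _ , e = ∈-map⁻ (λ i → b i 0) (∈-resp-↭ ys↭ (∈-map⁺ toℕ x∈)) in i , 0 , s≤s z≤n , sym e

    unsplit : ¬ Split v (fromList (pairs zs) , c)
    unsplit (p , p∈ , ≢c) with ∈-pairs⁻ zs-asc (∈-fromList⁻ (pairs zs) p∈)
    ... | x , y , x∈ , y∈ , x<y , refl =
      let i , x∈i = member x∈ ; j , y∈j = member y∈ in
      ≢c (trans (sym (lookupPair-toℕ v x y))
           (BlockSystem.mono B i j _ refl ((x<y ∷ []) ∷ [] ∷ []) (inj₁ x∈i ∷ inj₂ y∈j ∷ [])))

-- For cliques on `4 * n` vertices the exponent 1 + 4n² has to stay below 8n² - 2n, which holds from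
-- n = 1 on; with `3 * n` the corresponding inequality fails at n = 1. The number of pairs is
-- written in terms of `t`, with n = t + 1, to avoid subtraction.
pair-colouring : ∀ n → 1 ≤ n → PairColouring (2 ^ n) (4 * n)
pair-colouring (suc t) _ = random-pair-colouring (2 ^ n) (4 * n) e (tri t) (begin-strict
    2 * (2 ^ n) ^ (4 * n)    ≡⟨ cong (2 *_) (^-*-assoc 2 n (4 * n)) ⟩
    2 ^ (1 + n * (4 * n))    <⟨ ^-monoʳ-< 2 (s≤s (s≤s z≤n)) (subst (1 + n * (4 * n) <_) (sym (gap t)) (s≤s (m≤m+n _ _))) ⟩
    2 ^ e                    ∎)
  where
  open ≤-Reasoning
  n = suc t
  e = 8 * t * t + 14 * t + 6
  tri : ∀ t → 2 * (8 * t * t + 14 * t + 6) + 4 * suc t ≡ 4 * suc t * (4 * suc t)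
  tri = solve-∀
  gap : ∀ t → 8 * t * t + 14 * t + 6 ≡ suc (1 + suc t * (4 * suc t)) + (4 * t * t + 6 * t)
  gap = solve-∀

-- Iterating the step up the tower

tower : ℕ → ℕ → ℕ
tower zero          n = n
tower (suc zero)    n = n
tower (suc (suc k)) n = 2 ^ tower (suc k) n

Avoiding : ℕ → ℕ → ℕ → ℕ → Set
Avoiding k S N L = ∃ λ (χ : List ℕ → Fin 4) → ∀ c b → ¬ BlockSystem k S χ c N {L} b

-- `S` and `M` are chosen before `n`: they depend on `k` alone, and the constant of the theorem is
-- computed from them.
Avoidable : ℕ → Set
Avoidable k = ∃ λ S → ∃ λ M → 1 ≤ M × ∀ n → 1 ≤ n → Avoiding k S (tower k n) (M * n)

avoidable : ∀ k → Avoidable (2 + k)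
avoidable zero = 1 , 4 , s≤s z≤n , λ n 1≤n →
  let χ , avoids = pair-colouring n 1≤n in
  encode true ∘ χ , λ c b B → let open BlockSystem B in avoids (proj₂ (decode c)) b record
    { ascending = ascending
    ; bounded   = bounded
    ; disjoint  = disjoint
    ; mono      = λ i j xs len asc ins →
        trans (sym (cong proj₂ (decode-encode true (χ xs)))) (cong (proj₂ ∘ decode) (mono i j xs len asc ins))
    }
avoidable (suc zero) = 2 , 4 , s≤s z≤n , λ n 1≤n →
  let χ , avoids = pair-colouring n 1≤n in
  stepUp₂ (tower 2 n) χ , λ c b B → let c′ , v , B′ = stepUp₂-descends B in avoids c′ v B′
avoidable (suc (suc j)) with avoidable (suc j)
... | S , M , 1≤M , avoiding = core S + j , M + M , m≤n⇒m≤n+o M 1≤M , λ n 1≤n →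
  let χ , avoids = avoiding n 1≤n in
  stepUp (tower (3 + j) n) χ ,
  subst (λ L → ∀ c (b : Fin L → ℕ → ℕ) → ¬ BlockSystem (4 + j) (core S + j) (stepUp (tower (3 + j) n) χ) c (tower (4 + j) n) b)
    (sym (*-distribʳ-+ n M M))
    λ c b B → let v , B′ = stepUp-descends B in avoids c v B′

-- Used in contrapositive form: a colouring that avoids systems with small blocks avoids those with
-- larger blocks, so the blocks may be enlarged until each contains an edge.
shrink : ∀ {C : Set} {k S S′ N n χ} {c : C} {b} → S ≤ S′ → BlockSystem k S′ χ c N {n} b → BlockSystem k S χ c N {n} b
shrink {S = S} {S′} {b = b} S≤ B = record
  { ascending = λ i p<q q< → ascending i p<q (<-≤-trans q< S≤)
  ; bounded   = λ i p< → bounded i (<-≤-trans p< S≤)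
  ; disjoint  = λ i≢j p< q< → disjoint i≢j (<-≤-trans p< S≤) (<-≤-trans q< S≤)
  ; mono      = λ i j xs len asc ins → mono i j xs len asc (All.map (Sum.map widen widen) ins)
  }
  where
  open BlockSystem B
  widen : ∀ {i x} → Block S b i x → Block S′ b i x
  widen (p , p< , e) = p , <-≤-trans p< S≤ , e

-- The hypergraph of pairs of blocks

-- Turns the equality of vertex sets provided by `IsImage` into an equality of lists, which are what
-- the colourings take.
ascending-ext : ∀ {xs ys} → AllPairs _<_ xs → AllPairs _<_ ys →
                (∀ {z} → z List.∈ xs → z List.∈ ys) → (∀ {z} → z List.∈ ys → z List.∈ xs) → xs ≡ ys
ascending-ext []       []       _ _ = refl
ascending-ext []       (_ ∷ _)  _ g with () ← g (here refl)
ascending-ext (_ ∷ _)  []       f _ with () ← f (here refl)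
ascending-ext {x ∷ xs} {y ∷ ys} (x< ∷ ps) (y< ∷ qs) f g with f (here refl) | g (here refl)
... | there x∈ | there y∈ = contradiction (<-trans (All.lookup x< y∈) (All.lookup y< x∈)) (<-irrefl refl)
... | there x∈ | here refl = contradiction (All.lookup y< x∈) (<-irrefl refl)
... | here refl | _ = cong (x ∷_) (ascending-ext ps qs
  (λ z∈ → case f (there z∈) of λ { (here refl) → contradiction (All.lookup x< z∈) (<-irrefl refl) ; (there z∈′) → z∈′ })
  (λ z∈ → case g (there z∈) of λ { (here refl) → contradiction (All.lookup y< z∈) (<-irrefl refl) ; (there z∈′) → z∈′ }))

elements : ∀ {n} → Subset n → List ℕ
elements []            = []
elements (inside  ∷ p) = 0 ∷ map suc (elements p)
elements (outside ∷ p) = map suc (elements p)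

elements-ascending : ∀ {n} (p : Subset n) → AllPairs _<_ (elements p)
elements-ascending []            = []
elements-ascending (inside  ∷ p) = Allₚ.map⁺ (All.universal (λ _ → s≤s z≤n) _) ∷ AllPairsₚ.map⁺ (AllPairs.map s≤s (elements-ascending p))
elements-ascending (outside ∷ p) = AllPairsₚ.map⁺ (AllPairs.map s≤s (elements-ascending p))

∈-elements⁺ : ∀ {n} {x : Fin n} {p} → x ∈ p → toℕ x List.∈ elements p
∈-elements⁺ here = here refl
∈-elements⁺ {p = inside  ∷ p} (there x∈) = there (∈-map⁺ suc (∈-elements⁺ x∈))
∈-elements⁺ {p = outside ∷ p} (there x∈) = ∈-map⁺ suc (∈-elements⁺ x∈)

∈-elements⁻ : ∀ {n} (p : Subset n) {z} → z List.∈ elements p → ∃ λ x → x ∈ p × toℕ x ≡ z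
∈-elements⁻ (inside ∷ p) (here refl) = zero , here , refl
∈-elements⁻ (inside ∷ p) (there z∈) with ∈-map⁻ suc z∈
... | z′ , z∈′ , refl = let x , x∈ , e = ∈-elements⁻ p z∈′ in suc x , there x∈ , cong suc e
∈-elements⁻ (outside ∷ p) z∈ with ∈-map⁻ suc z∈
... | z′ , z∈′ , refl = let x , x∈ , e = ∈-elements⁻ p z∈′ in suc x , there x∈ , cong suc e

x∉p-x : ∀ {n} (p : Subset n) x → x ∉ p - x
x∉p-x (_ ∷ p) (suc x) (there x∈) = x∉p-x p x x∈

powerset : ∀ {n} → List (Fin n) → List (Subset n)
powerset []       = ⊥ ∷ []
powerset (x ∷ xs) = powerset xs ++ map (⁅ x ⁆ ∪_) (powerset xs)

length-powerset : ∀ {n} (xs : List (Fin n)) → length (powerset xs) ≡ 2 ^ length xs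
length-powerset []       = refl
length-powerset (x ∷ xs) = trans (length-++ (powerset xs)) (cong₂ _+_ (length-powerset xs)
  (trans (length-map _ (powerset xs)) (trans (length-powerset xs) (sym (+-identityʳ _)))))

∈-powerset : ∀ {n} xs (p : Subset n) → (∀ {y} → y ∈ p → y List.∈ xs) → p List.∈ powerset xs
∈-powerset [] p sub = here (Subsetₚ.Empty-unique λ (y , y∈) → case sub y∈ of λ ())
∈-powerset (x ∷ xs) p sub with x Subsetₚ.∈? p
... | no x∉ = ∈-++⁺ˡ (∈-powerset xs p λ y∈ → case sub y∈ of λ
        { (here refl) → contradiction y∈ x∉ ; (there y∈′) → y∈′ })
... | yes x∈ = ∈-++⁺ʳ (powerset xs) (subst (List._∈ map (⁅ x ⁆ ∪_) (powerset xs)) remove-insert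
        (∈-map⁺ (⁅ x ⁆ ∪_) (∈-powerset xs (p - x) λ y∈ → case sub (Subsetₚ.p─q⊆p p ⁅ x ⁆ y∈) of λ
          { (here refl) → contradiction y∈ (x∉p-x p x) ; (there y∈′) → y∈′ })))
  where
  into : ⁅ x ⁆ ∪ (p - x) ⊆ p
  into y∈ with Subsetₚ.x∈p∪q⁻ ⁅ x ⁆ (p - x) y∈
  ... | inj₁ y∈x = subst (_∈ p) (sym (Subsetₚ.x∈⁅y⁆⇒x≡y x y∈x)) x∈
  ... | inj₂ y∈p = Subsetₚ.p─q⊆p p ⁅ x ⁆ y∈p
  from : p ⊆ ⁅ x ⁆ ∪ (p - x)
  from {y} y∈ with y Finₚ.≟ x
  ... | yes refl = Subsetₚ.x∈p∪q⁺ (inj₁ (Subsetₚ.x∈⁅x⁆ x))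
  ... | no  y≢x  = Subsetₚ.x∈p∪q⁺ (inj₂ (Subsetₚ.x∈p∧x≢y⇒x∈p-y y∈ y≢x))
  remove-insert : ⁅ x ⁆ ∪ (p - x) ≡ p
  remove-insert = Subsetₚ.⊆-antisym into from

subset-of-size : ∀ {n} (p : Subset n) k → k ≤ ∣ p ∣ → ∃ λ q → q ⊆ p × ∣ q ∣ ≡ k
subset-of-size {n} p zero k≤ = ⊥ , Subsetₚ.⊥⊆ , Subsetₚ.∣⊥∣≡0 n
subset-of-size (inside  ∷ p) (suc k) (s≤s k≤) = let q , q⊆ , e = subset-of-size p k k≤ in
  inside ∷ q , Subsetₚ.in⊆in q⊆ , cong suc e
subset-of-size (outside ∷ p) (suc k) k≤ = let q , q⊆ , e = subset-of-size p (suc k) k≤ in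
  outside ∷ q , Subsetₚ.out⊆ q⊆ , e

subset-through : ∀ {n} {x : Fin n} (p : Subset n) k → x ∈ p → 1 ≤ k → k ≤ ∣ p ∣ →
                 ∃ λ q → x ∈ q × q ⊆ p × ∣ q ∣ ≡ k
subset-through (inside ∷ p) (suc k) here 1≤k (s≤s k≤) = let q , q⊆ , e = subset-of-size p k k≤ in
  inside ∷ q , here , Subsetₚ.in⊆in q⊆ , cong suc e
subset-through (outside ∷ p) k (there x∈) 1≤k k≤ = let q , x∈q , q⊆ , e = subset-through p k x∈ 1≤k k≤ in
  outside ∷ q , there x∈q , Subsetₚ.out⊆ q⊆ , e
subset-through (inside ∷ p) k (there x∈) 1≤k k≤ with m≤n⇒m<n∨m≡n k≤
... | inj₁ (s≤s k≤p) = let q , x∈q , q⊆ , e = subset-through p k x∈ 1≤k k≤p in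
  outside ∷ q , there x∈q , Subsetₚ.out⊆ q⊆ , e
... | inj₂ refl = inside ∷ p , there x∈ , (λ z → z) , refl

_≟ᴱ_ : ∀ {k n} → DecidableEquality (Edge k n)
(p , e) ≟ᴱ (q , e′) with Vecₚ.≡-dec Boolₚ._≟_ p q
... | yes refl = yes (cong (p ,_) (≡-irrelevant e e′))
... | no  p≢q  = no (p≢q ∘ cong proj₁)

toEdges : ∀ {n} k → List (Subset n) → List (Edge k n)
toEdges k []       = []
toEdges k (p ∷ ps) with ∣ p ∣ ≟ k
... | yes e = (p , e) ∷ toEdges k ps
... | no  _ = toEdges k ps

length-toEdges : ∀ {n} k (ps : List (Subset n)) → length (toEdges k ps) ≤ length ps
length-toEdges k []       = z≤n
length-toEdges k (p ∷ ps) with ∣ p ∣ ≟ k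
... | yes _ = s≤s (length-toEdges k ps)
... | no  _ = m≤n⇒m≤1+n (length-toEdges k ps)

∈-toEdges : ∀ {n} k {p : Subset n} {ps} (e : ∣ p ∣ ≡ k) → p List.∈ ps → (p , e) List.∈ toEdges k ps
∈-toEdges k {ps = p ∷ ps} e p∈ with ∣ p ∣ ≟ k | p∈
... | yes e′ | here refl = here (cong (p ,_) (≡-irrelevant e e′))
... | yes _  | there p∈′ = there (∈-toEdges k e p∈′)
... | no ¬e  | here refl = contradiction e ¬e
... | no _   | there p∈′ = ∈-toEdges k e p∈′

length-concatMap : ∀ {A B : Set} (f : A → List B) c xs → (∀ x → length (f x) ≡ c) →
                   length (concatMap f xs) ≡ length xs * c
length-concatMap f c []       h = refl
length-concatMap f c (x ∷ xs) h = trans (length-++ (f x)) (cong₂ _+_ (h x) (length-concatMap f c xs h))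

module BlockHypergraph (k L S : ℕ) (1≤k : 1 ≤ k) (k≤S : k ≤ S) where

  block : Fin L → List (Fin (L * S))
  block i = map (combine i) (allFin S)

  union : Fin L × Fin L → List (Fin (L * S))
  union (i , j) = block i ++ block j

  length-block : ∀ i → length (block i) ≡ S
  length-block i = trans (length-map (combine i) (allFin S)) (length-tabulate {n = S} (λ x → x))

  block-unique : ∀ i → Unique (block i)
  block-unique i = Uniqueₚ.map⁺ (λ {x} {y} → Finₚ.combine-injectiveʳ i x i y) (Uniqueₚ.allFin⁺ S)

  vertexSets : List (Subset (L * S))
  vertexSets = concatMap (powerset ∘ union) (cartesianProduct (allFin L) (allFin L))

  length-vertexSets : length vertexSets ≡ L * L * 2 ^ (S + S)
  length-vertexSets = trans
    (length-concatMap (powerset ∘ union) (2 ^ (S + S)) (cartesianProduct (allFin L) (allFin L))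
      λ (i , j) → trans (length-powerset (union (i , j)))
        (cong (2 ^_) (trans (length-++ (block i)) (cong₂ _+_ (length-block i) (length-block j)))))
    (cong (_* 2 ^ (S + S)) (trans (length-cartesianProductWith _,_ (allFin L) (allFin L))
      (cong₂ _*_ (length-tabulate {n = L} (λ x → x)) (length-tabulate {n = L} (λ x → x)))))

  hypergraph : Hypergraph k
  hypergraph = record
    { order    = L * S
    -- A set in the union of two blocks is listed for both orders of the pair, and a set inside a
    -- single block for every partner.
    ; edges    = deduplicate _≟ᴱ_ (toEdges k vertexSets)
    ; distinct = DecUniqueₚ.deduplicate-! _≟ᴱ_ (toEdges k vertexSets)
    }

  open Hypergraph hypergraph using (edges)

  size-hypergraph : size hypergraph ≤ L * L * 2 ^ (S + S)
  size-hypergraph = begin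
    length edges                  ≤⟨ length-deduplicate _≟ᴱ_ (toEdges k vertexSets) ⟩
    length (toEdges k vertexSets) ≤⟨ length-toEdges k vertexSets ⟩
    length vertexSets             ≡⟨ length-vertexSets ⟩
    L * L * 2 ^ (S + S)           ∎
    where open ≤-Reasoning

  edge : ∀ i j {p} (e : ∣ p ∣ ≡ k) → (∀ {y} → y ∈ p → y List.∈ union (i , j)) → (p , e) List.∈ edges
  edge i j {p} e sub = ∈-deduplicate⁺ _≟ᴱ_ (∈-toEdges k e (∈-concatMap⁺ (powerset ∘ union)
    (List.lose (∈-cartesianProduct⁺ (∈-allFin i) (∈-allFin j)) (∈-powerset (union (i , j)) p sub))))

  noIsolated : NoIsolatedVertices hypergraph
  noIsolated v with Finₚ.combine-surjective {L} {S} v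
  ... | i , x , refl =
    let q , v∈ , q⊆ , e = subset-through (fromList (block i)) k
          (∈-fromList⁺ (∈-map⁺ (combine i) (∈-allFin x))) 1≤k
          (≤-trans k≤S (≤-reflexive (sym (trans (∣fromList∣ (block-unique i)) (length-block i)))))
    in (q , e) , edge i i e (λ y∈ → ∈-++⁺ˡ (∈-fromList⁻ (block i) (q⊆ y∈))) , v∈

  at : List ℕ → ℕ → ℕ
  at []       p       = 0
  at (x ∷ xs) zero    = x
  at (x ∷ xs) (suc p) = at xs p

  at-∈ : ∀ xs {p} → p < length xs → at xs p List.∈ xs
  at-∈ (x ∷ xs) {zero}  _        = here refl
  at-∈ (x ∷ xs) {suc p} (s≤s p<) = there (at-∈ xs p<)

  at-ascending : ∀ {xs p q} → AllPairs _<_ xs → p < q → q < length xs → at xs p < at xs q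
  at-ascending {x ∷ xs} {zero}  {suc q} (x< ∷ _) _         (s≤s q<) = All.lookup x< (at-∈ xs q<)
  at-ascending {x ∷ xs} {suc p} {suc q} (_ ∷ ps) (s≤s p<q) (s≤s q<) = at-ascending ps p<q q<

  module _ {C : Set} {N : ℕ} (χ : List ℕ → C) (avoids : ∀ c b → ¬ BlockSystem k S χ c N {L} b)
           {r : ℕ} (r≤N : r ≤ N) (c : C) (f : Fin (L * S) → Fin r) (f-inj : ∀ {x y} → f x ≡ f y → x ≡ y)
           (copy : ∀ e → e List.∈ edges → ∃ λ (e′ : Edge k r) → IsImage f e e′ × χ (elements (proj₁ e′)) ≡ c) where

    image : Fin L → List ℕ
    image i = map (toℕ ∘ f) (block i)

    image-unique : ∀ i → Unique (image i)
    image-unique i = Uniqueₚ.map⁺ (f-inj ∘ Finₚ.toℕ-injective) (block-unique i)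

    -- The embedding `f` need not preserve the order of the vertices, so the image of a block
    -- becomes a block only after sorting.
    sorted : Fin L → List ℕ
    sorted i = proj₁ (ascending-sort (image-unique i))

    sorted-↭ : ∀ i → sorted i ↭ image i
    sorted-↭ i = proj₁ (proj₂ (ascending-sort (image-unique i)))

    length-sorted : ∀ i → length (sorted i) ≡ S
    length-sorted i = trans (↭-length (sorted-↭ i)) (trans (length-map (toℕ ∘ f) (block i)) (length-block i))

    b : Fin L → ℕ → ℕ
    b i = at (sorted i)

    preimage : ∀ {i x} → Block S b i x → ∃ λ v → v List.∈ block i × x ≡ toℕ (f v)
    preimage {i} (p , p< , refl) = ∈-map⁻ (toℕ ∘ f)
      (∈-resp-↭ (sorted-↭ i) (at-∈ (sorted i) (subst (p <_) (sym (length-sorted i)) p<)))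

    preimages : ∀ i j {xs} → All (InPair S b i j) xs → ∃ λ vs → map (toℕ ∘ f) vs ≡ xs × All (List._∈ union (i , j)) vs
    preimages i j [] = [] , refl , []
    preimages i j (x∈ ∷ ins) =
      let v , v∈ , e = vertex x∈ ; vs , e′ , vs∈ = preimages i j ins in
      v ∷ vs , cong₂ _∷_ (sym e) e′ , v∈ ∷ vs∈
      where
      vertex : ∀ {x} → InPair S b i j x → ∃ λ v → v List.∈ union (i , j) × x ≡ toℕ (f v)
      vertex (inj₁ x∈) = let v , v∈ , e = preimage x∈ in v , ∈-++⁺ˡ v∈ , e
      vertex (inj₂ x∈) = let v , v∈ , e = preimage x∈ in v , ∈-++⁺ʳ (block i) v∈ , e

    mono : ∀ i j xs → length xs ≡ k → AllPairs _<_ xs → All (InPair S b i j) xs → χ xs ≡ c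
    mono i j xs len asc ins with preimages i j ins
    ... | vs , refl , vs∈ with copy (fromList vs , card) (edge i j card λ y∈ → All.lookup vs∈ (∈-fromList⁻ vs y∈))
      where
      card : ∣ fromList vs ∣ ≡ k
      card = trans (∣fromList∣ (AllPairs.map (λ l e → <⇒≢ l (cong (toℕ ∘ f) e)) (AllPairsₚ.map⁻ asc)))
                   (trans (sym (length-map (toℕ ∘ f) vs)) len)
    ...   | (p , _) , img , χp≡c = trans (cong χ (ascending-ext asc (elements-ascending p) into from)) χp≡c
      where
      into : ∀ {z} → z List.∈ map (toℕ ∘ f) vs → z List.∈ elements p
      into z∈ = let v , v∈ , e = ∈-map⁻ (toℕ ∘ f) z∈ in
        subst (List._∈ elements p) (sym e) (∈-elements⁺ (Equivalence.from (img (f v)) (v , ∈-fromList⁺ v∈ , refl)))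
      from : ∀ {z} → z List.∈ elements p → z List.∈ map (toℕ ∘ f) vs
      from z∈ = let y , y∈ , e = ∈-elements⁻ p z∈ ; v , v∈ , e′ = Equivalence.to (img y) y∈ in
        subst (List._∈ map (toℕ ∘ f) vs) (trans (cong toℕ e′) e) (∈-map⁺ (toℕ ∘ f) (∈-fromList⁻ vs v∈))

    disjoint : ∀ {i j p q} → i ≢ j → p < S → q < S → b i p ≢ b j q
    disjoint {i} {j} i≢j p< q< e with preimage {i} (_ , p< , refl) | preimage {j} (_ , q< , refl)
    ... | v , v∈ , ev | w , w∈ , ew with ∈-map⁻ (combine i) v∈ | ∈-map⁻ (combine j) w∈
    ...   | x , _ , refl | y , _ , refl =
      i≢j (Finₚ.combine-injectiveˡ i x j y (f-inj (Finₚ.toℕ-injective (trans (sym ev) (trans e ew)))))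

    no-copy : Empty.⊥
    no-copy = avoids c b record
      { ascending = λ i p<q q< → at-ascending (proj₂ (proj₂ (ascending-sort (image-unique i)))) p<q
                                   (subst (_ <_) (sym (length-sorted i)) q<)
      ; bounded   = λ i p< → let v , _ , e = preimage {i} (_ , p< , refl) in
                      subst (_< N) (sym e) (<-≤-trans (Finₚ.toℕ<n (f v)) r≤N)
      ; disjoint  = disjoint
      ; mono      = mono
      }

  -- A colouring of lists restricts to the edges on `Fin r` for every `r ≤ N`, so a single χ refutes
  -- all these `r`.
  ramsey-bound : ∀ {q N r} (χ : List ℕ → Fin q) → (∀ c b → ¬ BlockSystem k S χ c N {L} b) →
                 IsRamsey hypergraph q r → N ≤ r
  ramsey-bound {N = N} {r} χ avoids ram with r ≤? N
  ... | no  r≰N = <⇒≤ (≰⇒> r≰N)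
  ... | yes r≤N = let c , f , f-inj , copy = ram (χ ∘ elements ∘ proj₁) in
    ⊥-elim (no-copy χ avoids r≤N c f f-inj copy)

-- Padding to a prescribed number of edges

record Padded {k} (p : ℕ) (H : Hypergraph k) : Set where
  field
    padded      : Hypergraph k
    size-padded : size padded ≡ p + size H
    noIsolated  : NoIsolatedVertices padded
    ramsey      : ∀ q n → IsRamsey padded q n → IsRamsey H q n

-- A new vertex together with a fixed set of k - 1 old ones adds exactly one edge and covers the new
-- vertex. The old hypergraph stays inside, so a Ramsey lower bound for it carries over.
module AddPendant {k} (H : Hypergraph k) (K : Subset (Hypergraph.order H)) (card : suc ∣ K ∣ ≡ k) where
  open Hypergraph H using (order; edges; distinct)

  shift : Edge k order → Edge k (suc order)
  shift (p , e) = outside ∷ p , e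

  pendant : Hypergraph k
  pendant = record
    { order    = suc order
    ; edges    = (inside ∷ K , card) ∷ map shift edges
    ; distinct = Allₚ.map⁺ (All.universal (λ e′ e → case cong (Vec.head ∘ proj₁) e of λ ()) edges)
                 ∷ Uniqueₚ.map⁺ (λ { refl → refl }) distinct
    }

  noIsolated-pendant : NoIsolatedVertices H → NoIsolatedVertices pendant
  noIsolated-pendant h zero    = _ , here refl , here
  noIsolated-pendant h (suc x) = let e , e∈ , x∈ = h x in shift e , there (∈-map⁺ shift e∈) , there x∈

  ramsey-pendant : ∀ q n → IsRamsey pendant q n → IsRamsey H q n
  ramsey-pendant q n ram χ =
    let i , f , f-inj , copy = ram χ in
    i , f ∘ suc , (λ e → Finₚ.suc-injective (f-inj e)) , λ e e∈ →
    let e′ , img , χe′ = copy (shift e) (there (∈-map⁺ shift e∈)) in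
    e′ , (λ y → mk⇔
      (λ y∈ → case Equivalence.to (img y) y∈ of λ { (suc x , there x∈ , fx≡y) → x , x∈ , fx≡y })
      (λ (x , x∈ , fx≡y) → Equivalence.from (img y) (suc x , there x∈ , fx≡y))) , χe′

pad : ∀ {k} p (H : Hypergraph k) (K : Subset (Hypergraph.order H)) → suc ∣ K ∣ ≡ k → NoIsolatedVertices H → Padded p H
pad zero    H K card h = record { padded = H ; size-padded = refl ; noIsolated = h ; ramsey = λ q n r → r }
pad (suc p) H K card h = record
  { padded      = P.padded
  ; size-padded = trans P.size-padded (trans (cong (λ l → p + suc l) (length-map shift (Hypergraph.edges H))) (+-suc p (size H)))
  ; noIsolated  = P.noIsolated
  ; ramsey      = λ q n → ramsey-pendant q n ∘ P.ramsey q n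
  }
  where
  open AddPendant H K card
  module P = Padded (pad p pendant (outside ∷ K) card (noIsolated-pendant h))

-- Rational bounds on the tower

infixr 8 _^ℚ_
_^ℚ_ : ℚ → ℕ → ℚ
_^ℚ_ = rawPower +-*-rawSemiring

⌜_⌝ : ℕ → ℚ
⌜ n ⌝ = ℤ.+ n / 1

toℚᵘ-/ : ∀ i d → toℚᵘ (i / suc d) ℚᵘ.≃ mkℚᵘ i d
toℚᵘ-/ i d = ℚₚ.toℚᵘ-fromℚᵘ (mkℚᵘ i d)

/-mono-≤ : ∀ a b d e → a * suc e ≤ b * suc d → ℤ.+ a / suc d ℚ.≤ ℤ.+ b / suc e
/-mono-≤ a b d e l = ℚₚ.toℚᵘ-cancel-≤ (begin
  toℚᵘ (ℤ.+ a / suc d)    ≃⟨ toℚᵘ-/ (ℤ.+ a) d ⟩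
  mkℚᵘ (ℤ.+ a) d          ≤⟨ ℚᵘ.*≤* (subst₂ ℤ._≤_ (ℤₚ.pos-* a (suc e)) (ℤₚ.pos-* b (suc d)) (ℤ.+≤+ l)) ⟩
  mkℚᵘ (ℤ.+ b) e          ≃⟨ ℚᵘₚ.≃-sym (toℚᵘ-/ (ℤ.+ b) e) ⟩
  toℚᵘ (ℤ.+ b / suc e)    ∎)
  where open ℚᵘₚ.≤-Reasoning

/-cancel-≤ : ∀ a b d e → ℤ.+ a / suc d ℚ.≤ ℤ.+ b / suc e → a * suc e ≤ b * suc d
/-cancel-≤ a b d e l with (begin
  mkℚᵘ (ℤ.+ a) d          ≃⟨ ℚᵘₚ.≃-sym (toℚᵘ-/ (ℤ.+ a) d) ⟩
  toℚᵘ (ℤ.+ a / suc d)    ≤⟨ ℚₚ.toℚᵘ-mono-≤ l ⟩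
  toℚᵘ (ℤ.+ b / suc e)    ≃⟨ toℚᵘ-/ (ℤ.+ b) e ⟩
  mkℚᵘ (ℤ.+ b) e          ∎)
  where open ℚᵘₚ.≤-Reasoning
... | ℚᵘ.*≤* l′ = ℤₚ.drop‿+≤+ (subst₂ ℤ._≤_ (sym (ℤₚ.pos-* a (suc e))) (sym (ℤₚ.pos-* b (suc d))) l′)

/-* : ∀ a b d → ℤ.+ a / suc d ℚ.* ⌜ b ⌝ ≡ ℤ.+ (a * b) / suc d
/-* a b d = ℚₚ.toℚᵘ-injective (begin-equality
  toℚᵘ (ℤ.+ a / suc d ℚ.* ⌜ b ⌝)           ≃⟨ ℚₚ.toℚᵘ-homo-* (ℤ.+ a / suc d) ⌜ b ⌝ ⟩
  toℚᵘ (ℤ.+ a / suc d) ℚᵘ.* toℚᵘ ⌜ b ⌝     ≃⟨ ℚᵘₚ.*-cong (toℚᵘ-/ (ℤ.+ a) d) (toℚᵘ-/ (ℤ.+ b) 0) ⟩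
  mkℚᵘ (ℤ.+ a) d ℚᵘ.* mkℚᵘ (ℤ.+ b) 0         ≃⟨ ℚᵘ.*≡* (cong₂ ℤ._*_ (sym (ℤₚ.pos-* a b)) (cong (λ n → ℤ.+ suc n) (sym (*-identityʳ d)))) ⟩
  mkℚᵘ (ℤ.+ (a * b)) d                     ≃⟨ ℚᵘₚ.≃-sym (toℚᵘ-/ (ℤ.+ (a * b)) d) ⟩
  toℚᵘ (ℤ.+ (a * b) / suc d)               ∎)
  where open ℚᵘₚ.≤-Reasoning

⌜⌝-mono-≤ : ∀ m n → m ≤ n → ⌜ m ⌝ ℚ.≤ ⌜ n ⌝
⌜⌝-mono-≤ m n m≤n = /-mono-≤ m n 0 0 (*-monoˡ-≤ 1 m≤n)

⌜⌝-nonNeg : ∀ n → ℚ.NonNegative ⌜ n ⌝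
⌜⌝-nonNeg n = ℚₚ.normalize-nonNeg n 1

⌜⌝-^ : ∀ a n → ⌜ a ^ n ⌝ ≡ ⌜ a ⌝ ^ℚ n
⌜⌝-^ a zero    = refl
⌜⌝-^ a (suc n) = trans (sym (/-* a (a ^ n) 0)) (cong (⌜ a ⌝ ℚ.*_) (⌜⌝-^ a n))

^ℚ-pos : ∀ p .{{_ : ℚ.Positive p}} n → ℚ.Positive (p ^ℚ n)
^ℚ-pos p zero    = _
^ℚ-pos p (suc n) = ℚₚ.pos*pos⇒pos p (p ^ℚ n) {{^ℚ-pos p n}}

^ℚ-mono-< : ∀ {p q} → ℚ.NonNegative p → p ℚ.< q → ∀ n → p ^ℚ suc n ℚ.< q ^ℚ suc n
^ℚ-mono-< {p} {q} 0≤p p<q zero    = subst₂ ℚ._<_ (sym (ℚₚ.*-identityʳ p)) (sym (ℚₚ.*-identityʳ q)) p<q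
^ℚ-mono-< {p} {q} 0≤p p<q (suc n) = begin-strict
  p ℚ.* p ^ℚ suc n   ≤⟨ ℚₚ.*-monoˡ-≤-nonNeg p {{0≤p}} (ℚₚ.<⇒≤ (^ℚ-mono-< 0≤p p<q n)) ⟩
  p ℚ.* q ^ℚ suc n   <⟨ ℚₚ.*-monoˡ-<-pos (q ^ℚ suc n) {{^ℚ-pos q {{0<q}} (suc n)}} p<q ⟩
  q ℚ.* q ^ℚ suc n   ∎
  where
  open ℚₚ.≤-Reasoning
  0<q : ℚ.Positive q
  0<q = ℚ.positive (ℚₚ.≤-<-trans (ℚₚ.nonNegative⁻¹ p {{0≤p}}) p<q)

sqrt-bound : ∀ s m B → s ℚ.* s ℚ.≤ ⌜ m ⌝ → m ≤ B * B → s ℚ.≤ ⌜ B ⌝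
sqrt-bound s m B s²≤m m≤B² with s ℚₚ.≤? ⌜ B ⌝
... | yes s≤B = s≤B
... | no  s≰B = contradiction (begin-strict
  ⌜ B * B ⌝          ≡⟨ trans (cong (λ n → ⌜ B * n ⌝) (sym (*-identityʳ B))) (⌜⌝-^ B 2) ⟩
  ⌜ B ⌝ ^ℚ 2         <⟨ ^ℚ-mono-< (⌜⌝-nonNeg B) (ℚₚ.≰⇒> s≰B) 1 ⟩
  s ℚ.* (s ℚ.* ℚ.1ℚ) ≡⟨ cong (s ℚ.*_) (ℚₚ.*-identityʳ s) ⟩
  s ℚ.* s            ≤⟨ s²≤m ⟩
  ⌜ m ⌝              ≤⟨ ⌜⌝-mono-≤ m (B * B) m≤B² ⟩
  ⌜ B * B ⌝          ∎) (ℚₚ.<-irrefl refl)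
  where open ℚₚ.≤-Reasoning

scaled-sqrt-bound : ∀ m n d → m ≤ (suc d * n) * (suc d * n) → (ℤ.+ 1 / suc d) · √ m ≤ᴿ n
scaled-sqrt-bound m n d m≤ p (s , (_ , s²≤m) , refl) = begin
  c ℚ.* s                      ≤⟨ ℚₚ.*-monoˡ-≤-nonNeg c {{ℚₚ.normalize-nonNeg 1 (suc d)}} (sqrt-bound s m (suc d * n) s²≤m m≤) ⟩
  c ℚ.* ⌜ suc d * n ⌝          ≡⟨ /-* 1 (suc d * n) d ⟩
  ℤ.+ (1 * (suc d * n)) / suc d  ≤⟨ /-mono-≤ (1 * (suc d * n)) n d 0 (≤-reflexive (lemma d n)) ⟩
  ⌜ n ⌝                        ∎
  where
  open ℚₚ.≤-Reasoning
  c = ℤ.+ 1 / suc d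
  lemma : ∀ d n → 1 * (suc d * n) * 1 ≡ n * suc d
  lemma = solve-∀

-- If `p` exceeded `2 ^ n`, its power `suc b` would exceed `2 ^ (n * suc b)`, which is at least
-- `2 ^ a` because a / (b + 1) belongs to `x` and so is at most `n`.
2^-bound : ∀ x n → x ≤ᴿ n → 2^ x ≤ᴿ 2 ^ n
2^-bound x n x≤n p (_ , a , b , a/b∈x , p^b≤) with p ℚₚ.≤? ⌜ 2 ^ n ⌝
... | yes p≤ = p≤
... | no  p≰ = contradiction (begin-strict
  ⌜ 2 ^ n ⌝ ^ℚ suc b         <⟨ ^ℚ-mono-< (⌜⌝-nonNeg (2 ^ n)) (ℚₚ.≰⇒> p≰) b ⟩
  p ^ℚ suc b                 ≤⟨ p^b≤ ⟩
  ⌜ 2 ^ a ⌝                  ≤⟨ ⌜⌝-mono-≤ (2 ^ a) (2 ^ (n * suc b)) (^-monoʳ-≤ 2 a≤) ⟩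
  ⌜ 2 ^ (n * suc b) ⌝        ≡⟨ cong ⌜_⌝ (sym (^-*-assoc 2 n (suc b))) ⟩
  ⌜ (2 ^ n) ^ suc b ⌝        ≡⟨ ⌜⌝-^ (2 ^ n) (suc b) ⟩
  ⌜ 2 ^ n ⌝ ^ℚ suc b         ∎) (ℚₚ.<-irrefl refl)
  where
  open ℚₚ.≤-Reasoning
  a≤ : a ≤ n * suc b
  a≤ = subst (_≤ n * suc b) (*-identityʳ a) (/-cancel-≤ a n b 0 (x≤n _ a/b∈x))

tw-bound : ∀ k x n → x ≤ᴿ n → tw k x ≤ᴿ tower k n
tw-bound zero          x n h = h
tw-bound (suc zero)    x n h = h
tw-bound (suc (suc k)) x n h = 2^-bound (tw (suc k) x) (tower (suc k) n) (tw-bound (suc k) x n h)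

≤ᴿ-trans : ∀ x m n → x ≤ᴿ m → m ≤ n → x ≤ᴿ n
≤ᴿ-trans x m n x≤m m≤n p p∈x = ℚₚ.≤-trans (x≤m p p∈x) (⌜⌝-mono-≤ m n m≤n)

-- This `n` is the integer part of √(m / (Q + 1)); it grows by at most one when `m` does.
quadratic-floor : ∀ Q m → ∃ λ n → suc Q * (n * n) ≤ m × m < suc Q * (suc n * suc n)
quadratic-floor Q zero = 0 , ≤-reflexive (*-zeroʳ Q) , s≤s z≤n
quadratic-floor Q (suc m) with quadratic-floor Q m
... | n , lo , hi with m≤n⇒m<n∨m≡n hi
...   | inj₁ hi′ = n , m≤n⇒m≤1+n lo , hi′
...   | inj₂ eq  = suc n , ≤-reflexive (sym eq) , subst (_< suc Q * (suc (suc n) * suc (suc n))) (sym eq)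
        (*-monoʳ-< (suc Q) (*-mono-< (n<1+n (suc n)) (n<1+n (suc n))))

-- Choice of the parameters for a given number of edges

module Bound (k S M : ℕ) (1≤M : 1 ≤ M)
             (avoiding : ∀ n → 1 ≤ n → Avoiding (suc k) S (tower (suc k) n) (M * n)) where

  -- The blocks have at least k vertices each, so that no vertex is isolated.  The hypergraph on M * n
  -- blocks has at most C n² edges, and the constant of the theorem is 1 / (2 (C + 1)).
  S′ C d : ℕ
  S′ = S + suc k
  C  = M * M * 2 ^ (S′ + S′)
  d  = C + suc C

  module _ (m : ℕ) (C<m : C < m) where

    n : ℕ
    n = proj₁ (quadratic-floor C m)

    n-lower : suc C * (n * n) ≤ m
    n-lower = proj₁ (proj₂ (quadratic-floor C m))

    n-upper : m < suc C * (suc n * suc n)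
    n-upper = proj₂ (proj₂ (quadratic-floor C m))

    -- This is where `m` has to be large: for `m ≤ C` the integer part `n` is 0 and no blocks
    -- remain.
    1≤n : 1 ≤ n
    1≤n with n | n-upper
    ... | zero  | m< = contradiction (subst (m <_) (*-identityʳ (suc C)) m<) (≤⇒≯ C<m)
    ... | suc _ | _  = s≤s z≤n

    open module B = BlockHypergraph (suc k) (M * n) S′ (s≤s z≤n) (m≤n+m (suc k) S) using (hypergraph)

    size≤m : size hypergraph ≤ m
    size≤m = begin
      size hypergraph                           ≤⟨ B.size-hypergraph ⟩
      M * n * (M * n) * 2 ^ (S′ + S′)           ≡⟨ lemma M n (2 ^ (S′ + S′)) ⟩
      C * (n * n)                               ≤⟨ *-monoˡ-≤ (n * n) (n≤1+n C) ⟩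
      suc C * (n * n)                           ≤⟨ n-lower ⟩
      m                                         ∎
      where
      open ≤-Reasoning
      lemma : ∀ M n p → M * n * (M * n) * p ≡ M * M * p * (n * n)
      lemma = solve-∀

    k≤order : k ≤ ∣ ⊤ {M * n * S′} ∣
    k≤order = begin
      k                       ≤⟨ n≤1+n k ⟩
      suc k                   ≤⟨ m≤n+m (suc k) S ⟩
      S′                      ≡⟨ sym (*-identityˡ S′) ⟩
      1 * 1 * S′              ≤⟨ *-monoˡ-≤ S′ (*-mono-≤ 1≤M 1≤n) ⟩
      M * n * S′              ≡⟨ sym (Subsetₚ.∣⊤∣≡n (M * n * S′)) ⟩
      ∣ ⊤ {M * n * S′} ∣      ∎
      where open ≤-Reasoning

    padding : Padded (m ∸ size hypergraph) hypergraph
    padding = let K , _ , card = subset-of-size ⊤ k k≤order in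
      pad (m ∸ size hypergraph) hypergraph K (cong suc card) B.noIsolated

    open Padded padding public using (padded; noIsolated)

    size≡m : size padded ≡ m
    size≡m = trans (Padded.size-padded padding) (m∸n+n≡m size≤m)

    tower≤ : ∀ r → IsRamsey padded 4 r → tower (suc k) n ≤ r
    tower≤ r ram = let χ , avoids = avoiding n 1≤n in
      B.ramsey-bound χ (λ c b → avoids c b ∘ shrink (m≤m+n S (suc k))) (Padded.ramsey padding 4 r ram)

    m≤square : m ≤ suc d * n * (suc d * n)
    m≤square = begin
      m                                      ≤⟨ <⇒≤ n-upper ⟩
      suc C * (suc n * suc n)                ≤⟨ *-monoʳ-≤ (suc C) (*-mono-≤ suc≤ suc≤) ⟩
      -- The added multiple raises the factor C + 1 to its square, so that the bound becomes a
      -- perfect square and the constant rational.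
      suc C * ((n + n) * (n + n))            ≤⟨ m≤m+n _ _ ⟩
      suc C * ((n + n) * (n + n)) + C * (suc C * ((n + n) * (n + n)))  ≡⟨ lemma C n ⟩
      suc d * n * (suc d * n)                ∎
      where
      open ≤-Reasoning
      suc≤ : suc n ≤ n + n
      suc≤ = +-monoˡ-≤ n 1≤n
      lemma : ∀ C n → suc C * ((n + n) * (n + n)) + C * (suc C * ((n + n) * (n + n))) ≡
                      suc (C + suc C) * n * (suc (C + suc C) * n)
      lemma = solve-∀

    bound : ∀ r → IsRamseyNumber padded 4 r → tw (suc k) ((ℤ.+ 1 / suc d) · √ m) ≤ᴿ r
    bound r (ram , _) = ≤ᴿ-trans _ (tower (suc k) n) r
      (tw-bound (suc k) _ n (scaled-sqrt-bound m n d m≤square)) (tower≤ r ram)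

theorem1p3 : ∀ (k : ℕ) → 2 ≤ k →
    ∃ λ (c : ℚ) → 0ℚ ℚ.< c ×
    ∃ λ (m₀ : ℕ) →
    ∀ (m : ℕ) → 1 ≤ m → m₀ ≤ m →
    ∃ λ (H : Hypergraph k) →
    size H ≡ m ×
    NoIsolatedVertices H ×
    (∀ (r : ℕ) → IsRamseyNumber H 4 r → tw k (c · √ m) ≤ᴿ r)
theorem1p3 (suc (suc k)) (s≤s (s≤s _)) =
  let S , M , 1≤M , avoiding = avoidable k
      module B = Bound (suc k) S M 1≤M avoiding
  in ℤ.+ 1 / suc B.d , ℚₚ.positive⁻¹ _ {{ℚₚ.normalize-pos 1 (suc B.d)}} , suc B.C , λ m _ C<m →
     B.padded m C<m , B.size≡m m C<m , B.noIsolated m C<m , B.bound m C<m
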